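{- The problem $k$-PERFECT CODE restricted to unit 2-track interval graphs is W[1]-hard with parameter $k$.
   Context: For a graph $H=(V,E)$ and $u\in V$, the closed neighborhood of $u$ is $N[u]=\{u\}\cup\{v\mid \{u,v\}\in E\}$. A perfect code in $H$ is a subset $V'\subseteq V$ that includes exactly one vertex from $N[u]$ for each vertex $u\in V$. $k$-PERFECT CODE: given a graph $H$ and an integer $k$, decide whether $H$ has a perfect code of size exactly $k$. The intersection graph of a family of sets has one vertex per member, two different members being adjacent iff they intersect; the family is a representation of the graph. A 2-track interval is the union of two intervals on two disjoint parallel lines (tracks), one interval on each track. A unit 2-track interval graph is the intersection graph of a family of 2-track intervals in which all intervals have unit length. Such a representation of $H$ is given as part of the input. A parameterized problem is W[1]-hard if every problem in W[1] has an FPT reduction to it; equivalently, if $k$-CLIQUE in general graphs (parameter $k$) has an FPT reduction to it. An FPT reduction maps an instance $(x,k)$ to an equivalent instance $(x',k')$ in time $g(k)\cdot|x|^{O(1)}$ with $k'\le h(k)$, for computable functions $g,h$. -}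

module Defs where

open import Level using (0ℓ)
open import Data.Bool.Base using (Bool; true; false; T)
open import Data.Nat.Base using (ℕ; zero; suc; _+_; _*_; _^_; _≤_)
open import Data.Integer.Base using (ℤ; +_; -[1+_])
open import Data.Rational.Unnormalised.Base as ℚ using (ℚᵘ; mkℚᵘ; 1ℚᵘ)
open import Data.Fin.Base using (Fin)
open import Data.Fin.Subset using (Subset; ∣_∣; _∈_)
open import Data.Product.Base using (∃; _×_; _,_)
open import Data.Product using (∃!)
open import Data.Sum.Base using (_⊎_)
open import Data.Vec.Functional using (Vector; foldr; map)
open import Function.Base using (_∘_)
open import Function.Bundles using (_⇔_)
open import Relation.Unary using (Pred; _⟨⊎⟩_; _≬_)
open import Relation.Binary.PropositionalEquality using (_≡_; _≢_)

data Tree : Set where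
  leaf : Tree
  node : Tree → Tree → Tree

size : Tree → ℕ
size leaf       = 1
size (node a b) = suc (size a + size b)

left right : Tree → Tree
left  leaf       = leaf
left  (node a b) = a
right leaf       = leaf
right (node a b) = b

-- A point-free variant of Jones's WHILE language (N. D. Jones,
-- "Computability and Complexity").  In tests, leaf means false and every
-- node means true.
infixr 5 _⨾_

data Prog : Set where
  idᵖ leafᵖ leftᵖ rightᵖ : Prog
  nodeᵖ                  : Prog → Prog → Prog
  _⨾_                    : Prog → Prog → Prog
  ifᵖ                    : Prog → Prog → Prog → Prog
  whileᵖ                 : Prog → Prog → Prog

-- ⟨ p , x ⟩⇓ y [ t ] : on input x, the program p halts with output y
-- after time t.  Every operation that reads or duplicates a tree is
-- charged the full size of that tree, so subtrees are never shared for
-- free: t bounds the sizes of all intermediate values and of y, and time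
-- agrees with Turing machine time up to a polynomial.
infix 4 ⟨_,_⟩⇓_[_]

data ⟨_,_⟩⇓_[_] : Prog → Tree → Tree → ℕ → Set where
  id-⇓    : ∀ {x} → ⟨ idᵖ    , x ⟩⇓ x       [ size x ]
  leaf-⇓  : ∀ {x} → ⟨ leafᵖ  , x ⟩⇓ leaf    [ size x ]
  left-⇓  : ∀ {x} → ⟨ leftᵖ  , x ⟩⇓ left x  [ size x ]
  right-⇓ : ∀ {x} → ⟨ rightᵖ , x ⟩⇓ right x [ size x ]
  node-⇓  : ∀ {p q x y z s t} →
            ⟨ p , x ⟩⇓ y [ s ] → ⟨ q , x ⟩⇓ z [ t ] →
            ⟨ nodeᵖ p q , x ⟩⇓ node y z [ size x + s + t ]
  ⨾-⇓     : ∀ {p q x y z s t} →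
            ⟨ p , x ⟩⇓ y [ s ] → ⟨ q , y ⟩⇓ z [ t ] →
            ⟨ p ⨾ q , x ⟩⇓ z [ s + t ]
  if-true : ∀ {b p q x y a c r s} →
            ⟨ b , x ⟩⇓ node a c [ r ] → ⟨ p , x ⟩⇓ y [ s ] →
            ⟨ ifᵖ b p q , x ⟩⇓ y [ size x + r + s ]
  if-false : ∀ {b p q x y r s} →
            ⟨ b , x ⟩⇓ leaf [ r ] → ⟨ q , x ⟩⇓ y [ s ] →
            ⟨ ifᵖ b p q , x ⟩⇓ y [ size x + r + s ]
  while-stop : ∀ {b p x r} →
            ⟨ b , x ⟩⇓ leaf [ r ] →
            ⟨ whileᵖ b p , x ⟩⇓ x [ size x + r ]
  while-step : ∀ {b p x y z a c r s t} →
            ⟨ b , x ⟩⇓ node a c [ r ] → ⟨ p , x ⟩⇓ y [ s ] →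
            ⟨ whileᵖ b p , y ⟩⇓ z [ t ] →
            ⟨ whileᵖ b p , x ⟩⇓ z [ size x + r + s + t ]

-- Unary numerals: harmless for a parameter, since an FPT reduction can write
-- k out in unary, and for the target problem of a hardness result they only
-- make the claim stronger than binary ones would.
encodeℕ : ℕ → Tree
encodeℕ zero    = leaf
encodeℕ (suc n) = node leaf (encodeℕ n)

encodeBool : Bool → Tree
encodeBool false = leaf
encodeBool true  = node leaf leaf

encodeℤ : ℤ → Tree
encodeℤ (+ n)      = node (encodeBool false) (encodeℕ n)
encodeℤ (-[1+ n ]) = node (encodeBool true)  (encodeℕ n)

encodeℚ : ℚᵘ → Tree
encodeℚ (mkℚᵘ p q-1) = node (encodeℤ p) (encodeℕ q-1)

encodeVector : ∀ {A : Set} {n} → (A → Tree) → Vector A n → Tree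
encodeVector enc v = foldr node leaf (map enc v)

Computable : (ℕ → ℕ) → Set
Computable f =
  ∃ λ p → ∀ n → ∃ λ t → ⟨ p , encodeℕ n ⟩⇓ encodeℕ (f n) [ t ]

record ParameterizedProblem : Set₁ where
  field
    Instance  : Set
    encode    : Instance → Tree
    parameter : Instance → ℕ
    Yes       : Pred Instance 0ℓ

record FPTReduction (P Q : ParameterizedProblem) : Set where
  private
    module P = ParameterizedProblem P
    module Q = ParameterizedProblem Q
  field
    reduce       : P.Instance → Q.Instance
    equivalent   : ∀ x → P.Yes x ⇔ Q.Yes (reduce x)
    program      : Prog
    g            : ℕ → ℕ
    g-computable : Computable g
    exponent     : ℕ
    computes     : ∀ x → ∃ λ t →
                   ⟨ program , P.encode x ⟩⇓ Q.encode (reduce x) [ t ] ×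
                   t ≤ g (P.parameter x) * size (P.encode x) ^ exponent
    h            : ℕ → ℕ
    h-computable : Computable h
    parameter-≤  : ∀ x → Q.parameter (reduce x) ≤ h (P.parameter x)

record Graph : Set where
  field
    order       : ℕ
    adjacent    : Fin order → Fin order → Bool
    symmetric   : ∀ u v → adjacent u v ≡ adjacent v u
    irreflexive : ∀ v → adjacent v v ≡ false

  Vertex : Set
  Vertex = Fin order

  Adj : Vertex → Vertex → Set
  Adj u v = T (adjacent u v)

  N[_] : Vertex → Pred Vertex 0ℓ
  N[ u ] v = v ≡ u ⊎ Adj u v

encodeGraph : Graph → Tree
encodeGraph G = encodeVector (encodeVector encodeBool) (Graph.adjacent G)

module _ (G : Graph) where
  open Graph G

  IsClique : Subset order → Set
  IsClique S = ∀ u v → u ∈ S → v ∈ S → u ≢ v → Adj u v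

  IsPerfectCode : Subset order → Set
  IsPerfectCode S = ∀ u → ∃! _≡_ λ v → v ∈ S × N[ u ] v

  HasClique : ℕ → Set
  HasClique k = ∃ λ S → IsClique S × ∣ S ∣ ≡ k

  HasPerfectCode : ℕ → Set
  HasPerfectCode k = ∃ λ S → IsPerfectCode S × ∣ S ∣ ≡ k

  IsRepresentation : {Point : Set} → (Vertex → Pred Point 0ℓ) → Set
  IsRepresentation F = ∀ u v → u ≢ v → Adj u v ⇔ F u ≬ F v

kClique : ParameterizedProblem
kClique = record
  { Instance  = Graph × ℕ
  ; encode    = λ (G , k) → node (encodeGraph G) (encodeℕ k)
  ; parameter = λ (_ , k) → k
  ; Yes       = λ (G , k) → HasClique G k
  }

-- k-Clique is W[1]-complete, so a reduction from it is equivalent to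
-- reductions from all of W[1].
W[1]-Hard : ParameterizedProblem → Set
W[1]-Hard = FPTReduction kClique

-- Rational points suffice: two closed intervals with rational endpoints
-- meet in a real point iff they meet in a rational one.
unitInterval : ℚᵘ → Pred ℚᵘ 0ℓ
unitInterval a x = a ℚ.≤ x × x ℚ.≤ a ℚ.+ 1ℚᵘ

-- The two tracks are the two summands of ℚᵘ ⊎ ℚᵘ.
record Unit2TrackInterval : Set where
  field
    start₁ start₂ : ℚᵘ

  points : Pred (ℚᵘ ⊎ ℚᵘ) 0ℓ
  points = unitInterval start₁ ⟨⊎⟩ unitInterval start₂

encode2Track : Unit2TrackInterval → Tree
encode2Track I = node (encodeℚ start₁) (encodeℚ start₂)
  where open Unit2TrackInterval I

record Unit2TrackIntervalGraph : Set where
  field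
    graph            : Graph
    family           : Vector Unit2TrackInterval (Graph.order graph)
    isRepresentation : IsRepresentation graph (Unit2TrackInterval.points ∘ family)

encodeUnit2TrackIntervalGraph : Unit2TrackIntervalGraph → Tree
encodeUnit2TrackIntervalGraph H =
  node (encodeGraph graph) (encodeVector encode2Track family)
  where open Unit2TrackIntervalGraph H

kPerfectCode-Unit2TrackIntervalGraph : ParameterizedProblem
kPerfectCode-Unit2TrackIntervalGraph = record
  { Instance  = Unit2TrackIntervalGraph × ℕ
  ; encode    = λ (H , k) → node (encodeUnit2TrackIntervalGraph H) (encodeℕ k)
  ; parameter = λ (_ , k) → k
  ; Yes       = λ (H , k) → HasPerfectCode (Unit2TrackIntervalGraph.graph H) k
  }

{-# OPTIONS --safe #-}
module Submission where

-- Choosing k pairwise adjacent vertices φ(0), …, φ(k − 1) amounts to choosing,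
-- in every cell (a , b) of a k × k grid, a pair (u , v) = (φ(a) , φ(b)), where
-- u = v on the diagonal, u and v are adjacent off the diagonal, u is constant
-- along rows and v along columns.  Such a pair is a 2-track interval which
-- records u by its position on track 1 and v by its position on track 2.
--
-- Along each row, n + 1 dummy intervals between consecutive cells enforce the
-- constancy of u: the r-th dummy meets the pair (u , v) of its own cell iff
-- u < r, and the pair (u′ , v′) of the preceding cell iff r ≤ u′, so it is
-- dominated exactly once for all r iff u = u′.  Columns use track 2.
--
-- In a perfect code every cell contains a chosen pair, or else a chosen row
-- dummy and a chosen column dummy.  Hence a code of size k² contains exactly
-- one pair per cell and no dummies.

open import Defs
open import Data.Bool.Base using (Bool; true; false; if_then_else_; not; _∧_; _∨_; T)
open import Data.Bool.Properties using (T-∧; T-∨; T?)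
open import Data.Empty using (⊥-elim)
open import Data.Fin.Base using (Fin; zero; suc; toℕ; fromℕ<; remQuot; combine)
open import Data.Fin.Properties as Fin using (toℕ<n; toℕ-fromℕ<; toℕ-injective; combine-remQuot; remQuot-combine)
open import Data.Fin.Subset using (Subset; ∣_∣; _∈_; _∉_; inside; _-_) renaming (⊥ to ∅)
open import Data.Fin.Subset.Properties using (x∈p∧x≢y⇒x∈p-y; x∈p⇒∣p-x∣<∣p∣; ∉⊥; ∣⊥∣≡0)
import Data.Integer.Base as ℤ
import Data.Integer.Properties as ℤ
open import Data.List.Base
  using (List; []; _∷_; _++_; length; map; foldl; foldr; reverse; replicate; drop; lookup;
         tabulate; upTo; downFrom; filterᵇ; cartesianProduct)
open import Data.List.Properties
  using (map-is-foldr; ++-is-foldr; reverse-foldl; reverse-downFrom;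
         length-map; length-++; length-replicate; length-tabulate)
open import Data.List.Membership.Propositional using () renaming (_∈_ to _∈ˡ_)
open import Data.List.Membership.Propositional.Properties
  using (∈-filter⁺; ∈-filter⁻; ∈-cartesianProduct⁺; ∈-cartesianProduct⁻; ∈-upTo⁺; ∈-upTo⁻; ∈-lookup)
open import Data.List.Relation.Unary.All as All using (All; []; _∷_)
import Data.List.Relation.Unary.All.Properties as All
open import Data.List.Relation.Unary.AllPairs using ([]; _∷_)
open import Data.List.Relation.Unary.Any as Any using (here; there)
open import Data.List.Relation.Unary.Any.Properties using (lookup-index)
open import Data.List.Relation.Unary.Unique.Propositional using (Unique)
import Data.List.Relation.Unary.Unique.Propositional.Properties as Unique
open import Data.Nat.Base
open import Data.Nat.Properties
open import Data.Product.Base as Product using (∃; _×_; _,_; proj₁; proj₂; swap; uncurry)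
open import Data.Rational.Unnormalised.Base as ℚ using (ℚᵘ; mkℚᵘ; 1ℚᵘ; *≤*)
import Data.Rational.Unnormalised.Properties as ℚ
open import Data.Sum.Base as Sum using (_⊎_; inj₁; inj₂)
open import Data.Unit.Base using (⊤; tt)
open import Data.Vec.Base as Vec using ([]; _∷_; _[_]≔_)
import Data.Vec.Properties as Vec
open import Function.Base using (id; _∘_; flip; case_of_)
open import Function.Bundles using (_⇔_; mk⇔; Equivalence)
open import Relation.Binary.Definitions using (tri<; tri≈; tri>)
open import Relation.Binary.PropositionalEquality
open import Relation.Nullary.Decidable using (yes; no)
open import Relation.Nullary.Negation using (¬_; contradiction)
open import Relation.Unary using (_≬_)

open Equivalence using (to; from)

-- Polynomial-time functions between encoded types

-- The theorem asks for an actual program with a time bound, so each function of the reduction is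
-- assembled from combinators that carry a program and an exponent along with it; no program is
-- analysed separately. The outcome runs in polynomial time, and the parameter dependence is
-- confined to the step from k to k².
--
-- What forces a pair or dummies into every cell is the dummy with r = n, the guard of its cell. All
-- pairs satisfy u < n, so a row guard meets every pair of its own cell and none of the preceding
-- one; apart from these it meets exactly the row dummies of its cell. The selected nodes that
-- dominate the k² row guards therefore lie in different cells and already exhaust a code of size
-- k². A column dummy meets no row guard, so none is selected. The column guards must then be
-- dominated by pairs, and a selected pair excludes every row dummy of its cell, since both would
-- dominate the same row guard.

record Type : Set₁ where
  constructor type
  field
    Carrier : Set
    encode  : Carrier → Tree

open Type

infixr 4 _⊗_

encodeList : ∀ {A : Set} → (A → Tree) → List A → Tree
encodeList enc []       = leaf
encodeList enc (x ∷ xs) = node (enc x) (encodeList enc xs)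

𝕌 𝔹 ℕᵗ : Type
𝕌  = type ⊤ (λ _ → leaf)
𝔹  = type Bool encodeBool
ℕᵗ = type ℕ encodeℕ

_⊗_ : Type → Type → Type
A ⊗ B = type (Carrier A × Carrier B) λ (x , y) → node (encode A x) (encode B y)

Listᵗ : Type → Type
Listᵗ A = type (List (Carrier A)) (encodeList (encode A))

measure : (A : Type) → Carrier A → ℕ
measure A x = size (encode A x)

size>0 : ∀ x → 1 ≤ size x
size>0 leaf       = ≤-refl
size>0 (node x y) = s≤s z≤n

size-left : ∀ x → size (left x) ≤ size x
size-left leaf       = ≤-refl
size-left (node x y) = m≤n⇒m≤1+n (m≤m+n (size x) (size y))

size-right : ∀ x → size (right x) ≤ size x
size-right leaf       = ≤-refl
size-right (node x y) = m≤n⇒m≤1+n (m≤n+m (size y) (size x))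

-- Each rule charges at least the size of the tree it returns. A time bound is thus also a bound on
-- the output, which is what composition of programs requires.
output-size : ∀ {p x y t} → ⟨ p , x ⟩⇓ y [ t ] → size y ≤ t
output-size id-⇓            = ≤-refl
output-size (leaf-⇓ {x})    = size>0 x
output-size (left-⇓ {x})    = size-left x
output-size (right-⇓ {x})   = size-right x
output-size (node-⇓ {x = x} d e) =
  +-mono-≤ (+-mono-≤ (size>0 x) (output-size d)) (output-size e)
output-size (⨾-⇓ d e)       = m≤n⇒m≤o+n _ (output-size e)
output-size (if-true d e)   = m≤n⇒m≤o+n _ (output-size e)
output-size (if-false d e)  = m≤n⇒m≤o+n _ (output-size e)
output-size (while-stop {x = x} {r = r} d) = m≤m+n (size x) r
output-size (while-step d e f) = m≤n⇒m≤o+n _ (output-size f)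

-- A record rather than a plain inequality: the exponents of programs are closed
-- terms, and unifying bare powers would make Agda evaluate them.
record Bound (s e n : ℕ) : Set where
  constructor bound
  field
    bounded : n ≤ (2 + s) ^ e

open Bound

bound-mono : ∀ {s d e m n} → d ≤ e → m ≤ n → Bound s d n → Bound s e m
bound-mono {s} d≤e m≤n (bound p) = bound (≤-trans m≤n (≤-trans p (^-monoʳ-≤ (2 + s) d≤e)))

-- The base `2 + s` is at least two even for `s = 0`, so doubling costs one exponent. Sums of bounds
-- can therefore be absorbed without constants.
double-power : ∀ s e → (2 + s) ^ e + (2 + s) ^ e ≤ (2 + s) ^ suc e
double-power s e = begin
  (2 + s) ^ e + (2 + s) ^ e   ≡⟨ cong ((2 + s) ^ e +_) (sym (+-identityʳ _)) ⟩
  2 * (2 + s) ^ e             ≤⟨ *-monoˡ-≤ ((2 + s) ^ e) (m≤m+n 2 s) ⟩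
  (2 + s) ^ suc e             ∎
  where open ≤-Reasoning

bound-const : ∀ {s} c → Bound s c c
bound-const     zero    = bound z≤n
bound-const {s} (suc c) = bound
  (≤-trans (+-mono-≤ (m^n>0 (2 + s) c) (bounded (bound-const c))) (double-power s c))

bound-self : ∀ {s} → Bound s 1 s
bound-self {s} = bound (≤-trans (m≤n+m s 2) (≤-reflexive (sym (*-identityʳ (2 + s)))))

infixl 6 _⊞_
infixl 7 _⊠_

_⊞_ : ∀ {s d e m n} → Bound s d m → Bound s e n → Bound s (suc (d + e)) (m + n)
_⊞_ {s} {d} {e} p q = bound (≤-trans
  (+-mono-≤ (bounded (bound-mono (m≤m+n d e) ≤-refl p))
            (bounded (bound-mono (m≤n+m e d) ≤-refl q)))
  (double-power s (d + e)))

_⊠_ : ∀ {s d e m n} → Bound s d m → Bound s e n → Bound s (d + e) (m * n)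
_⊠_ {s} {d} {e} (bound p) (bound q) =
  bound (≤-trans (*-mono-≤ p q) (≤-reflexive (sym (^-distribˡ-+-* (2 + s) d e))))

bound-^ : ∀ {s d n} e → Bound s d n → Bound s (e * d) (n ^ e)
bound-^ zero    p = bound ≤-refl
bound-^ (suc e) p = p ⊠ bound-^ e p

-- The inner bound enters through `2 + m`, whose own exponent is `suc (2 + d)`: two for the
-- constant, one for the sum.
bound-∘ : ∀ {s d e m n} → Bound s d m → Bound m e n → Bound s (e * suc (2 + d)) n
bound-∘ {e = e} p (bound q) = bound-mono ≤-refl q (bound-^ e (bound-const 2 ⊞ p))

-- The function is an index, not a field, so that `extensional` and `reencode` can replace it, or
-- its codomain, and keep the program.
record PolyTime (A B : Type) (f : Carrier A → Carrier B) : Set where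
  field
    program  : Prog
    exponent : ℕ
    computes : ∀ x → ∃ λ t → ⟨ program , encode A x ⟩⇓ encode B (f x) [ t ] ×
               Bound (measure A x) exponent t

  measure-bound : ∀ x → Bound (measure A x) exponent (measure B (f x))
  measure-bound x = let t , run , t≤ = computes x in bound-mono ≤-refl (output-size run) t≤

open PolyTime

private variable
  A B C Γ : Type

-- Changes of type that leave the tree as it is are computed by `idᵖ`.
recode : ∀ {A B f} → (∀ x → encode A x ≡ encode B (f x)) → PolyTime A B f
recode eq = record
  { program  = idᵖ
  ; exponent = 1
  ; computes = λ x → _ , subst (λ y → ⟨ idᵖ , _ ⟩⇓ y [ _ ]) (eq x) id-⇓ , bound-self
  }

identity : PolyTime A A id
identity = recode (λ _ → refl)

infixr 9 _∙_

_∙_ : ∀ {f g} → PolyTime B C g → PolyTime A B f → PolyTime A C (λ x → g (f x))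
_∙_ {f = f} P Q = record
  { program  = program Q ⨾ program P
  ; exponent = _
  ; computes = λ x →
      let s , runQ , s≤ = computes Q x
          t , runP , t≤ = computes P (f x)
      in s + t , ⨾-⇓ runQ runP , s≤ ⊞ bound-∘ (measure-bound Q x) t≤
  }

reencode : ∀ {f g} → (∀ x → encode B (f x) ≡ encode C (g x)) → PolyTime A B f → PolyTime A C g
reencode eq P = record
  { program  = program P
  ; exponent = exponent P
  ; computes = λ x → let t , run , t≤ = computes P x in
      t , subst (λ y → ⟨ program P , _ ⟩⇓ y [ t ]) (eq x) run , t≤
  }

extensional : ∀ {f g} → (∀ x → f x ≡ g x) → PolyTime A B f → PolyTime A B g
extensional {B = B} eq = reencode (λ x → cong (encode B) (eq x))

infixr 4 _&_

_&_ : ∀ {f g} → PolyTime Γ A f → PolyTime Γ B g → PolyTime Γ (A ⊗ B) (λ x → f x , g x)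
_&_ P Q = record
  { program  = nodeᵖ (program P) (program Q)
  ; exponent = _
  ; computes = λ x →
      let s , runP , s≤ = computes P x
          t , runQ , t≤ = computes Q x
      in _ , node-⇓ runP runQ , bound-self ⊞ s≤ ⊞ t≤
  }

viaLeft : ∀ {A B f} → (∀ x → left (encode A x) ≡ encode B (f x)) → PolyTime A B f
viaLeft {A = A} eq = record
  { program  = leftᵖ
  ; exponent = 1
  ; computes = λ x → _ , subst (λ y → ⟨ leftᵖ , encode A x ⟩⇓ y [ _ ]) (eq x) left-⇓ , bound-self
  }

viaRight : ∀ {A B f} → (∀ x → right (encode A x) ≡ encode B (f x)) → PolyTime A B f
viaRight {A = A} eq = record
  { program  = rightᵖ
  ; exponent = 1
  ; computes = λ x → _ , subst (λ y → ⟨ rightᵖ , encode A x ⟩⇓ y [ _ ]) (eq x) right-⇓ , bound-self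
  }

first : PolyTime (A ⊗ B) A proj₁
first = viaLeft (λ _ → refl)

second : PolyTime (A ⊗ B) B proj₂
second = viaRight (λ _ → refl)

-- `tree` builds the encoding node by node, as the sole value of a one-point type. Repacking the
-- fields moves the result to `B`, because the fields mention only encodings.
constant : (y : Carrier B) → PolyTime A B (λ _ → y)
constant {B = B} {A = A} y = record { PolyTime (tree (encode B y)) }
  where
  tree : ∀ y → PolyTime A (type ⊤ (λ _ → y)) _
  tree leaf = record
    { program = leafᵖ ; exponent = 1 ; computes = λ x → _ , leaf-⇓ , bound-self }
  tree (node x y) = record { PolyTime (tree x & tree y) }

conditional : ∀ {c f g} → PolyTime Γ 𝔹 c → PolyTime Γ A f → PolyTime Γ A g →
              PolyTime Γ A (λ x → if c x then f x else g x)
conditional {Γ = Γ} {A = A} {c = c} {f} {g} T P Q = record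
  { program  = ifᵖ (program T) (program P) (program Q)
  ; exponent = _
  ; computes = run
  }
  where
  run : ∀ x → ∃ λ t → ⟨ _ , encode Γ x ⟩⇓ encode A (if c x then f x else g x) [ t ] ×
        Bound (measure Γ x) (suc (suc (1 + exponent T) + (exponent P + exponent Q))) t
  run x with c x | computes T x
  ... | true  | r , runT , r≤ =
    let s , runP , s≤ = computes P x in
    _ , if-true runT runP , bound-self ⊞ r≤ ⊞ bound-mono (m≤m+n _ _) ≤-refl s≤
  ... | false | r , runT , r≤ =
    let s , runQ , s≤ = computes Q x in
    _ , if-false runT runQ , bound-self ⊞ r≤ ⊞ bound-mono (m≤n+m _ (exponent P)) ≤-refl s≤

-- Loops over lists

-- The step also receives the remaining tail: in a loop over a unary numeral its length is the
-- current counter, which `upToᵖ` needs.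
foldTails : ∀ {A B : Set} → (A × List A → B → B) → List A → B → B
foldTails f []       y = y
foldTails f (x ∷ xs) y = foldTails f xs (f (x , xs) y)

length≤measure : ∀ A xs → length xs ≤ measure (Listᵗ A) xs
length≤measure A []       = z≤n
length≤measure A (x ∷ xs) = s≤s (≤-trans (length≤measure A xs) (m≤n+m _ _))

-- Since the increment does not depend on the accumulator, all intermediate
-- accumulators, and with them the running time, stay polynomial.
loop : ∀ {f d} (increment : Carrier (A ⊗ Listᵗ A) → Carrier Γ → ℕ) →
       (∀ x γ → Bound (measure ((A ⊗ Listᵗ A) ⊗ Γ) (x , γ)) d (increment x γ)) →
       (∀ x y γ → measure B (f (x , y , γ)) ≤ measure B y + increment x γ) →
       PolyTime ((A ⊗ Listᵗ A) ⊗ B ⊗ Γ) B f →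
       PolyTime (Listᵗ A ⊗ B ⊗ Γ) B
         (λ (xs , y , γ) → foldTails (λ x y → f (x , y , γ)) xs y)
loop {A = A} {Γ = Γ} {B = B} {f = f} {d} increment inc≤ growth step = record
  -- The left part of a state is the list still to be read, encoded by `leaf` exactly when it is
  -- empty, so `leftᵖ` serves as the loop test.
  { program  = whileᵖ leftᵖ (program body) ⨾ rightᵖ ⨾ leftᵖ
  ; exponent = _
  ; computes = λ (xs , y , γ) → run xs y γ _ ≤-refl _ ≤-refl (M-bound xs y γ)
      (K-bound xs y γ (M-bound xs y γ))
  }
  where
  State = Listᵗ A ⊗ B ⊗ Γ

  body : PolyTime ((A ⊗ Listᵗ A) ⊗ B ⊗ Γ) State
           (λ (x , y , γ) → proj₂ x , f (x , y , γ) , γ)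
  body = second ∙ first & step & second ∙ second

  -- Bounds valid throughout the run: `c` for one increment, `S` for the remaining list, `R` for the
  -- accumulator, `M` for the whole state and `K` for the cost of one round.
  module Iteration (γ : Carrier Γ) (c S R : ℕ)
    (c-max : ∀ x → measure (A ⊗ Listᵗ A) x ≤ S →
             (2 + measure ((A ⊗ Listᵗ A) ⊗ Γ) (x , γ)) ^ d ≤ c)
    (M : ℕ) (M-max : 2 + S + R + measure Γ γ ≤ M)
    (K : ℕ) (K-max : M + M + (2 + M) ^ exponent body ≤ K) where
    open ≤-Reasoning

    result : List (Carrier A) → Carrier B → Carrier State
    result xs y = [] , foldTails (λ x y → f (x , y , γ)) xs y , γ

    state≤ : ∀ {X Y} → X ≤ S → Y ≤ R → suc (X + suc (Y + measure Γ γ)) ≤ M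
    state≤ {X} {Y} X≤ Y≤ = begin
      suc (X + suc (Y + measure Γ γ)) ≡⟨ cong suc (+-suc X _) ⟩
      2 + (X + (Y + measure Γ γ))     ≡⟨ cong (2 +_) (sym (+-assoc X Y _)) ⟩
      2 + (X + Y + measure Γ γ)       ≤⟨ +-monoʳ-≤ 2 (+-monoˡ-≤ _ (+-mono-≤ X≤ Y≤)) ⟩
      2 + S + R + measure Γ γ         ≤⟨ M-max ⟩
      M                               ∎

    stop-cost : ∀ {a} → a ≤ M → a + a ≤ 1 * K
    stop-cost {a} a≤ = begin
      a + a                             ≤⟨ +-mono-≤ a≤ a≤ ⟩
      M + M                             ≤⟨ m≤m+n (M + M) _ ⟩
      M + M + (2 + M) ^ exponent body   ≤⟨ K-max ⟩
      K                                 ≡⟨ sym (*-identityˡ K) ⟩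
      1 * K                             ∎

    step-cost : ∀ {a t u} L → a ≤ M → Bound a (exponent body) t → u ≤ L * K →
                a + a + t + u ≤ suc L * K
    step-cost {a} {t} {u} L a≤ (bound t≤) u≤ = begin
      a + a + t + u
        ≤⟨ +-mono-≤ (+-mono-≤ (+-mono-≤ a≤ a≤) (≤-trans t≤ (^-monoˡ-≤ (exponent body) (+-monoʳ-≤ 2 a≤)))) u≤ ⟩
      M + M + (2 + M) ^ exponent body + L * K
        ≤⟨ +-monoˡ-≤ (L * K) K-max ⟩
      suc L * K ∎

    acc≤ : ∀ x y {L} → measure (A ⊗ Listᵗ A) x ≤ S → measure B y + suc L * c ≤ R →
           measure B (f (x , y , γ)) + L * c ≤ R
    acc≤ x y {L} x≤ y≤ = begin
      measure B (f (x , y , γ)) + L * c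
        ≤⟨ +-monoˡ-≤ (L * c) (growth x y γ) ⟩
      measure B y + increment x γ + L * c
        ≤⟨ +-monoˡ-≤ (L * c) (+-monoʳ-≤ (measure B y) (≤-trans (bounded (inc≤ x γ)) (c-max x x≤))) ⟩
      measure B y + c + L * c
        ≡⟨ +-assoc (measure B y) c (L * c) ⟩
      measure B y + suc L * c
        ≤⟨ y≤ ⟩
      R ∎

    -- The invariant reserves `c` for every element not yet read, so the accumulator never exceeds
    -- `R`.
    iterate : ∀ xs y → measure (Listᵗ A) xs ≤ S → measure B y + length xs * c ≤ R →
              ∃ λ t → ⟨ whileᵖ leftᵖ (program body) , encode State (xs , y , γ) ⟩⇓
                        encode State (result xs y) [ t ] ×
                      measure State (result xs y) ≤ M ×
                      t ≤ suc (length xs) * K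
    iterate [] y xs≤ y≤ = _ , while-stop left-⇓ , st≤ , stop-cost st≤
      where
      st≤ : measure State ([] , y , γ) ≤ M
      st≤ = state≤ xs≤ (≤-trans (m≤m+n _ _) y≤)
    iterate (x ∷ xs) y xs≤ y≤ =
      let s , runB , s≤ = computes body ((x , xs) , y , γ)
          t , run , final≤ , t≤ = iterate xs (f ((x , xs) , y , γ))
            (≤-trans (m≤n⇒m≤1+n (m≤n+m _ _)) xs≤) (acc≤ (x , xs) y {length xs} xs≤ y≤)
      in _ , while-step left-⇓ runB run , final≤ , step-cost (suc (length xs)) st≤ s≤ t≤
      where
      st≤ : measure State (x ∷ xs , y , γ) ≤ M
      st≤ = state≤ xs≤ (≤-trans (m≤m+n _ _) y≤)

  module _ (xs : List (Carrier A)) (y : Carrier B) (γ : Carrier Γ) where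
    s X c : ℕ
    s = measure State (xs , y , γ)
    X = measure (Listᵗ A) xs
    c = (2 + s) ^ d

    X≤ : X ≤ s
    X≤ = m≤n⇒m≤1+n (m≤m+n X _)

    y≤ : measure B y ≤ s
    y≤ = m≤n⇒m≤1+n (≤-trans (m≤n⇒m≤1+n (m≤m+n _ _)) (m≤n+m _ X))

    γ≤ : measure Γ γ ≤ s
    γ≤ = m≤n⇒m≤1+n (≤-trans (m≤n⇒m≤1+n (m≤n+m _ (measure B y))) (m≤n+m _ X))

    L≤ : length xs ≤ s
    L≤ = ≤-trans (length≤measure A xs) X≤

    M-bound : Bound s (suc (suc (suc (2 + 1) + suc (1 + (1 + d))) + 1))
                (2 + X + (s + s * c) + measure Γ γ)
    M-bound = bound-const 2 ⊞ bound-mono ≤-refl X≤ bound-self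
      ⊞ (bound-self ⊞ bound-self ⊠ bound {s} {d} ≤-refl) ⊞ bound-mono ≤-refl γ≤ bound-self

    K-bound : ∀ {M m} → Bound s m M →
              Bound s (suc (suc (m + m) + exponent body * suc (2 + m))) (M + M + (2 + M) ^ exponent body)
    K-bound M≤ = M≤ ⊞ M≤ ⊞ bound-^ (exponent body) (bound-const 2 ⊞ M≤)

    run : ∀ M (M-max : 2 + X + (s + s * c) + measure Γ γ ≤ M)
            K (K-max : M + M + (2 + M) ^ exponent body ≤ K) {m k} →
          Bound s m M → Bound s k K →
          ∃ λ t → ⟨ whileᵖ leftᵖ (program body) ⨾ rightᵖ ⨾ leftᵖ , encode State (xs , y , γ) ⟩⇓
                    encode B (foldTails (λ x y → f (x , y , γ)) xs y) [ t ] ×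
                  Bound s (suc (suc (1 + 1) + k + suc (m + m))) t
    run M M-max K K-max M≤ K≤ =
      let t , run , final≤ , t≤ = Iteration.iterate γ c X (s + s * c)
            (λ x x≤ → ^-monoˡ-≤ d (+-monoʳ-≤ 3 (+-mono-≤ x≤ (m≤n⇒m≤1+n (m≤n+m _ (measure B y))))))
            M M-max K K-max xs y ≤-refl (+-mono-≤ y≤ (*-monoˡ-≤ c L≤))
      in _ , ⨾-⇓ run (⨾-⇓ right-⇓ left-⇓) ,
         bound-mono ≤-refl
           (+-mono-≤ (≤-trans t≤ (*-monoˡ-≤ K (s≤s L≤)))
             (+-mono-≤ final≤ (≤-trans (size-right (encode State ([] , _ , γ))) final≤)))
           ((bound-const 1 ⊞ bound-self) ⊠ K≤ ⊞ (M≤ ⊞ M≤))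

consᵖ : PolyTime (A ⊗ Listᵗ A) (Listᵗ A) (λ (x , xs) → x ∷ xs)
consᵖ = recode (λ _ → refl)

tailᵖ : PolyTime (Listᵗ A) (Listᵗ A) (drop 1)
tailᵖ {A = A} = viaRight right-encode
  where
  right-encode : ∀ xs → right (encode (Listᵗ A) xs) ≡ encode (Listᵗ A) (drop 1 xs)
  right-encode []       = refl
  right-encode (x ∷ xs) = refl

headOr : ∀ {A : Set} → A → List A → A
headOr d []      = d
headOr d (x ∷ _) = x

-- On the empty list `leftᵖ` returns `leaf`, so the default has to be the value encoded by `leaf`.
headᵖ : ∀ {d} → encode A d ≡ leaf → PolyTime (Listᵗ A) A (headOr d)
headᵖ {A = A} {d} eq = viaLeft left-encode
  where
  left-encode : ∀ xs → left (encode (Listᵗ A) xs) ≡ encode A (headOr d xs)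
  left-encode []       = sym eq
  left-encode (x ∷ xs) = refl

bound-fst : ∀ {X G e n} → Bound X e n → Bound (suc (X + G)) e n
bound-fst {e = e} (bound p) =
  bound (≤-trans p (^-monoˡ-≤ e (+-monoʳ-≤ 2 (m≤n⇒m≤1+n (m≤m+n _ _)))))

foldlᵖ : ∀ {f d} (increment : Carrier A → Carrier Γ → ℕ) →
         (∀ x γ → Bound (measure (A ⊗ Γ) (x , γ)) d (increment x γ)) →
         (∀ x y γ → measure B (f (x , y , γ)) ≤ measure B y + increment x γ) →
         PolyTime (A ⊗ B ⊗ Γ) B f →
         PolyTime (Listᵗ A ⊗ B ⊗ Γ) B (λ (xs , y , γ) → foldl (λ y x → f (x , y , γ)) y xs)
foldlᵖ {A = A} {Γ = Γ} {B = B} {f = f} {d} increment inc≤ growth step =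
  extensional (λ (xs , y , γ) → eq xs y γ)
    (loop (λ (x , _) γ → increment x γ)
      (λ (x , xs) γ → bound {e = d} (≤-trans (bounded (inc≤ x γ))
        (^-monoˡ-≤ d (+-monoʳ-≤ 3 (+-monoˡ-≤ (measure Γ γ) (m≤n⇒m≤1+n (m≤m+n _ (measure (Listᵗ A) xs))))))))
      (λ (x , _) → growth x)
      (step ∙ (first ∙ first & second)))
  where
  eq : ∀ xs y γ → foldTails (λ x y → f (proj₁ x , y , γ)) xs y ≡ foldl (λ y x → f (x , y , γ)) y xs
  eq []       y γ = refl
  eq (x ∷ xs) y γ = eq xs (f (x , y , γ)) γ

reverseᵖ : PolyTime (Listᵗ A) (Listᵗ A) reverse
reverseᵖ {A = A} =
  foldlᵖ {Γ = 𝕌} (λ x _ → 1 + measure A x) (λ x _ → bound-const 1 ⊞ bound-fst bound-self)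
    (λ x y _ → ≤-reflexive (+-comm (suc (measure A x)) _))
    (consᵖ ∙ (first & first ∙ second))
  ∙ (identity & constant [] & constant tt)

-- A loop consumes its list from the front, so a right fold runs as a left fold over the reversed
-- list.
foldrᵖ : ∀ {f xs y d} (increment : Carrier A → Carrier Γ → ℕ) →
         (∀ x γ → Bound (measure (A ⊗ Γ) (x , γ)) d (increment x γ)) →
         (∀ x y γ → measure B (f (x , y , γ)) ≤ measure B y + increment x γ) →
         PolyTime (A ⊗ B ⊗ Γ) B f →
         PolyTime Γ (Listᵗ A) xs → PolyTime Γ B y →
         PolyTime Γ B (λ γ → foldr (λ x y → f (x , y , γ)) (y γ) (xs γ))
foldrᵖ {B = B} {f = f} {xs} {y} increment inc≤ growth step P Q = extensional
  (λ γ → reverse-foldl (λ y x → f (x , y , γ)) (y γ) (xs γ))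
  (foldlᵖ increment inc≤ growth step ∙ (reverseᵖ ∙ P & Q & identity))

infixr 5 _⟨∷⟩_ _⟨++⟩_

_⟨∷⟩_ : ∀ {f g} → PolyTime Γ A f → PolyTime Γ (Listᵗ A) g → PolyTime Γ (Listᵗ A) (λ γ → f γ ∷ g γ)
P ⟨∷⟩ Q = consᵖ ∙ (P & Q)

mapᵖ : ∀ {f xs} → PolyTime (A ⊗ Γ) B f → PolyTime Γ (Listᵗ A) xs →
       PolyTime Γ (Listᵗ B) (λ γ → map (λ x → f (x , γ)) (xs γ))
mapᵖ {A = A} {Γ = Γ} {B = B} {f = f} {xs} P Q = extensional
  (λ γ → sym (map-is-foldr (xs γ)))
  (foldrᵖ (λ x γ → 1 + measure B (f (x , γ)))
    (λ x γ → bound-const 1 ⊞ measure-bound P (x , γ))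
    (λ x y γ → ≤-reflexive (+-comm (suc (measure B (f (x , γ)))) _))
    (P ∙ (first & second ∙ second) ⟨∷⟩ first ∙ second) Q (constant []))

_⟨++⟩_ : ∀ {xs ys} → PolyTime Γ (Listᵗ A) xs → PolyTime Γ (Listᵗ A) ys →
         PolyTime Γ (Listᵗ A) (λ γ → xs γ ++ ys γ)
_⟨++⟩_ {A = A} {xs = xs} {ys} P Q = extensional
  (λ γ → sym (++-is-foldr (xs γ) (ys γ)))
  (foldrᵖ (λ x γ → 1 + measure A x)
    (λ x γ → bound-const 1 ⊞ bound-fst bound-self)
    (λ x y γ → ≤-reflexive (+-comm (suc (measure A x)) _))
    (first ⟨∷⟩ first ∙ second) P Q)

measure-++ : ∀ (A : Type) xs ys → measure (Listᵗ A) (xs ++ ys) ≤ measure (Listᵗ A) ys + measure (Listᵗ A) xs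
measure-++ A []       ys = m≤m+n _ 1
measure-++ A (x ∷ xs) ys = begin
  suc (measure A x + measure (Listᵗ A) (xs ++ ys))
    ≤⟨ +-monoʳ-≤ (suc (measure A x)) (measure-++ A xs ys) ⟩
  suc (measure A x) + (measure (Listᵗ A) ys + measure (Listᵗ A) xs)
    ≡⟨ +-comm-middle (suc (measure A x)) (measure (Listᵗ A) ys) _ ⟩
  measure (Listᵗ A) ys + (suc (measure A x) + measure (Listᵗ A) xs) ∎
  where
  open ≤-Reasoning
  +-comm-middle : ∀ a b c → a + (b + c) ≡ b + (a + c)
  +-comm-middle a b c = trans (sym (+-assoc a b c)) (trans (cong (_+ c) (+-comm a b)) (+-assoc b a c))

filterᵖ : ∀ {p xs} → PolyTime (A ⊗ Γ) 𝔹 p → PolyTime Γ (Listᵗ A) xs →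
          PolyTime Γ (Listᵗ A) (λ γ → filterᵇ (λ x → p (x , γ)) (xs γ))
filterᵖ {A = A} {Γ = Γ} {p = p} {xs} P Q = extensional (λ γ → is-foldr γ (xs γ))
  (foldrᵖ (λ x γ → 1 + measure A x) (λ x γ → bound-const 1 ⊞ bound-fst bound-self)
    growth
    (conditional (P ∙ (first & second ∙ second)) (first ⟨∷⟩ first ∙ second) (first ∙ second))
    Q (constant []))
  where
  growth : ∀ x ys γ → measure (Listᵗ A) (if p (x , γ) then x ∷ ys else ys) ≤ measure (Listᵗ A) ys + suc (measure A x)
  growth x ys γ with p (x , γ)
  ... | true  = ≤-reflexive (+-comm (suc (measure A x)) _)
  ... | false = m≤m+n _ _
  is-foldr : ∀ γ xs → foldr (λ x ys → if p (x , γ) then x ∷ ys else ys) [] xs ≡ filterᵇ (λ x → p (x , γ)) xs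
  is-foldr γ []       = refl
  is-foldr γ (x ∷ xs) with p (x , γ)
  ... | true  = cong (x ∷_) (is-foldr γ xs)
  ... | false = is-foldr γ xs

infixr 4 _⟨×⟩_

_⟨×⟩_ : ∀ {xs ys} → PolyTime Γ (Listᵗ A) xs → PolyTime Γ (Listᵗ B) ys →
        PolyTime Γ (Listᵗ (A ⊗ B)) (λ γ → cartesianProduct (xs γ) (ys γ))
_⟨×⟩_ {A = A} {B = B} {xs = xs} {ys} P Q = extensional
  (λ γ → is-foldr (xs γ) (ys γ))
  (foldrᵖ (λ x γ → measure (Listᵗ (A ⊗ B)) (map (x ,_) (ys γ)))
    (λ x γ → measure-bound row (x , γ))
    (λ x zs γ → measure-++ (A ⊗ B) (map (x ,_) (ys γ)) zs)
    (row ∙ (first & second ∙ second) ⟨++⟩ first ∙ second)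
    P (constant []))
  where
  row = mapᵖ (first ∙ second & first) (Q ∙ second {A = A})
  is-foldr : ∀ xs ys → foldr (λ x zs → map (x ,_) ys ++ zs) [] xs ≡ cartesianProduct xs ys
  is-foldr []       ys = refl
  is-foldr (x ∷ xs) ys = cong (map (x ,_) ys ++_) (is-foldr xs ys)

-- Arithmetic and tests on unary numerals

-- A unary numeral and a list of units are the same tree; recursion on numbers thereby becomes a
-- loop over a list.
unitsᵖ : PolyTime ℕᵗ (Listᵗ 𝕌) (λ n → replicate n tt)
unitsᵖ = recode encode-units
  where
  encode-units : ∀ n → encodeℕ n ≡ encode (Listᵗ 𝕌) (replicate n tt)
  encode-units zero    = refl
  encode-units (suc n) = cong (node leaf) (encode-units n)

lengthᵖ : PolyTime (Listᵗ A) ℕᵗ length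
lengthᵖ = extensional (λ xs → length-map (λ _ → tt) xs)
  (recode encode-length ∙ mapᵖ (constant tt) identity)
  where
  encode-length : ∀ xs → encode (Listᵗ 𝕌) xs ≡ encodeℕ (length xs)
  encode-length []       = refl
  encode-length (x ∷ xs) = cong (node leaf) (encode-length xs)

sucᵖ : PolyTime ℕᵗ ℕᵗ suc
sucᵖ = recode {A = 𝕌 ⊗ ℕᵗ} (λ _ → refl) ∙ (constant tt & identity)

predᵖ : PolyTime ℕᵗ ℕᵗ pred
predᵖ = viaRight right-encode
  where
  right-encode : ∀ n → right (encodeℕ n) ≡ encodeℕ (pred n)
  right-encode zero    = refl
  right-encode (suc n) = refl

-- The tails of n units have lengths n - 1, ..., 0. Each is pushed to the front in turn, which
-- leaves the numbers in increasing order.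
upToᵖ : PolyTime ℕᵗ (Listᵗ ℕᵗ) upTo
upToᵖ = extensional (λ n → trans (is-downFrom n []) (reverse-downFrom n))
  (loop {Γ = 𝕌}
    (λ (_ , xs) _ → 1 + measure ℕᵗ (length xs))
    (λ x γ → bound-const 1 ⊞ measure-bound (lengthᵖ ∙ second ∙ first {A = 𝕌 ⊗ Listᵗ 𝕌} {B = 𝕌}) (x , γ))
    (λ (_ , xs) ys _ → ≤-reflexive (+-comm (suc (measure ℕᵗ (length xs))) (measure (Listᵗ ℕᵗ) ys)))
    (lengthᵖ ∙ second ∙ first ⟨∷⟩ first ∙ second)
    ∙ (unitsᵖ & constant [] & constant tt))
  where
  is-downFrom : ∀ n (ys : List ℕ) →
    foldTails (λ ((_ , xs) : ⊤ × List ⊤) (ys : List ℕ) → length xs ∷ ys) (replicate n tt) ys ≡ foldl (flip _∷_) ys (downFrom n)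
  is-downFrom zero    ys = refl
  is-downFrom (suc n) ys rewrite length-replicate n {tt} = is-downFrom n (n ∷ ys)

infixl 6 _⟨+⟩_ _⟨∸⟩_
infixl 7 _⟨*⟩_

_⟨+⟩_ : ∀ {f g} → PolyTime Γ ℕᵗ f → PolyTime Γ ℕᵗ g → PolyTime Γ ℕᵗ (λ γ → f γ + g γ)
_⟨+⟩_ {f = f} {g} P Q = extensional
  (λ γ → trans (length-++ (replicate (f γ) tt))
    (cong₂ _+_ (length-replicate (f γ)) (length-replicate (g γ))))
  (lengthᵖ ∙ (unitsᵖ ∙ P ⟨++⟩ unitsᵖ ∙ Q))

_⟨*⟩_ : ∀ {f g} → PolyTime Γ ℕᵗ f → PolyTime Γ ℕᵗ g → PolyTime Γ ℕᵗ (λ γ → f γ * g γ)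
_⟨*⟩_ {f = f} {g} P Q = extensional
  (λ γ → is-* (f γ) (g γ))
  (foldrᵖ (λ x γ → measure ℕᵗ (g γ)) (λ x γ → measure-bound (Q ∙ second {A = 𝕌}) (x , γ))
    (λ x y γ → measure-+ (g γ) y)
    (Q ∙ second ∙ second ⟨+⟩ first ∙ second) (unitsᵖ ∙ P) (constant 0))
  where
  measure-+ : ∀ m n → measure ℕᵗ (m + n) ≤ measure ℕᵗ n + measure ℕᵗ m
  measure-+ zero    n = m≤m+n _ 1
  measure-+ (suc m) n = ≤-trans (+-monoʳ-≤ 2 (measure-+ m n))
    (≤-reflexive (trans (+-comm 2 _) (trans (+-assoc (measure ℕᵗ n) _ 2) (cong (measure ℕᵗ n +_) (+-comm _ 2)))))
  is-* : ∀ m n → foldr (λ _ y → n + y) 0 (replicate m tt) ≡ m * n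
  is-* zero    n = refl
  is-* (suc m) n = cong (n +_) (is-* m n)

_⟨∸⟩_ : ∀ {f g} → PolyTime Γ ℕᵗ f → PolyTime Γ ℕᵗ g → PolyTime Γ ℕᵗ (λ γ → f γ ∸ g γ)
_⟨∸⟩_ {f = f} {g} P Q = extensional
  (λ γ → is-∸ (f γ) (g γ))
  (foldrᵖ {d = 0} (λ x γ → 0) (λ x γ → bound z≤n) (λ x y γ → ≤-trans (measure-pred y) (m≤m+n _ 0))
    (predᵖ ∙ first ∙ second) (unitsᵖ ∙ Q) P)
  where
  measure-pred : ∀ n → measure ℕᵗ (pred n) ≤ measure ℕᵗ n
  measure-pred zero    = ≤-refl
  measure-pred (suc n) = m≤n+m _ 2
  is-∸ : ∀ m n → foldr (λ _ y → pred y) m (replicate n tt) ≡ m ∸ n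
  is-∸ m zero    = refl
  is-∸ m (suc n) = trans (cong pred (is-∸ m n)) (pred[m∸n]≡m∸[1+n] m n)

dropᵖ : ∀ {n xs} → PolyTime Γ ℕᵗ n → PolyTime Γ (Listᵗ A) xs → PolyTime Γ (Listᵗ A) (λ γ → drop (n γ) (xs γ))
dropᵖ {A = A} {n = n} {xs} P Q = extensional
  (λ γ → is-drop (n γ) (xs γ))
  (foldrᵖ {d = 0} (λ x γ → 0) (λ x γ → bound z≤n) (λ x y γ → ≤-trans (measure-tail y) (m≤m+n _ 0))
    (tailᵖ ∙ first ∙ second) (unitsᵖ ∙ P) Q)
  where
  measure-tail : ∀ xs → measure (Listᵗ A) (drop 1 xs) ≤ measure (Listᵗ A) xs
  measure-tail []       = ≤-refl
  measure-tail (x ∷ xs) = m≤n⇒m≤1+n (m≤n+m _ (measure A x))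
  is-drop : ∀ n xs → foldr (λ _ y → drop 1 y) xs (replicate n tt) ≡ drop n xs
  is-drop zero    xs = refl
  is-drop (suc n) xs = trans (cong (drop 1) (is-drop n xs)) (drop-drop n xs)
    where
    drop-drop : ∀ n xs → drop 1 (drop n xs) ≡ drop (suc n) xs
    drop-drop zero    xs       = refl
    drop-drop (suc n) []       = refl
    drop-drop (suc n) (x ∷ xs) = drop-drop n xs

infix 4 _⟨≤⟩_ _⟨≡⟩_
infixr 6 _⟨∧⟩_
infixr 5 _⟨∨⟩_

⟨not⟩_ : ∀ {f} → PolyTime Γ 𝔹 f → PolyTime Γ 𝔹 (λ γ → not (f γ))
⟨not⟩_ {f = f} P = extensional eq (conditional P (constant false) (constant true))
  where
  eq : ∀ γ → (if f γ then false else true) ≡ not (f γ)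
  eq γ with f γ
  ... | true  = refl
  ... | false = refl

_⟨∧⟩_ : ∀ {f g} → PolyTime Γ 𝔹 f → PolyTime Γ 𝔹 g → PolyTime Γ 𝔹 (λ γ → f γ ∧ g γ)
_⟨∧⟩_ {f = f} {g} P Q = extensional eq (conditional P Q (constant false))
  where
  eq : ∀ γ → (if f γ then g γ else false) ≡ f γ ∧ g γ
  eq γ with f γ
  ... | true  = refl
  ... | false = refl

_⟨∨⟩_ : ∀ {f g} → PolyTime Γ 𝔹 f → PolyTime Γ 𝔹 g → PolyTime Γ 𝔹 (λ γ → f γ ∨ g γ)
_⟨∨⟩_ {f = f} {g} P Q = extensional eq (conditional P (constant true) Q)
  where
  eq : ∀ γ → (if f γ then true else g γ) ≡ f γ ∨ g γ
  eq γ with f γ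
  ... | true  = refl
  ... | false = refl

isZeroᵖ : PolyTime ℕᵗ 𝔹 (_≡ᵇ 0)
isZeroᵖ = record
  { program  = ifᵖ idᵖ leafᵖ (nodeᵖ leafᵖ leafᵖ)
  ; exponent = _
  ; computes = λ where
      zero    → _ , if-false id-⇓ (node-⇓ leaf-⇓ leaf-⇓) ,
                bound-self {1} ⊞ bound-self ⊞ (bound-self ⊞ bound-self ⊞ bound-self)
      (suc n) → _ , if-true id-⇓ leaf-⇓ ,
                bound-self ⊞ bound-self ⊞ bound-mono {d = 1} (s≤s z≤n) ≤-refl bound-self
  }

_⟨≤⟩_ : ∀ {f g} → PolyTime Γ ℕᵗ f → PolyTime Γ ℕᵗ g → PolyTime Γ 𝔹 (λ γ → f γ ≤ᵇ g γ)
_⟨≤⟩_ {f = f} {g} P Q = extensional (λ γ → is-≤ (f γ) (g γ)) (isZeroᵖ ∙ (P ⟨∸⟩ Q))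
  where
  is-≤ : ∀ m n → (m ∸ n ≡ᵇ 0) ≡ (m ≤ᵇ n)
  is-≤ zero    zero    = refl
  is-≤ zero    (suc n) = refl
  is-≤ (suc m) zero    = refl
  is-≤ (suc m) (suc n) = trans (is-≤ m n) (≤ᵇ-suc m n)
    where
    ≤ᵇ-suc : ∀ m n → (m ≤ᵇ n) ≡ (m <ᵇ suc n)
    ≤ᵇ-suc zero    n = refl
    ≤ᵇ-suc (suc m) n = refl

_⟨≡⟩_ : ∀ {f g} → PolyTime Γ ℕᵗ f → PolyTime Γ ℕᵗ g → PolyTime Γ 𝔹 (λ γ → f γ ≡ᵇ g γ)
_⟨≡⟩_ {f = f} {g} P Q = extensional (λ γ → is-≡ (f γ) (g γ)) (isZeroᵖ ∙ (P ⟨∸⟩ Q) ⟨∧⟩ isZeroᵖ ∙ (Q ⟨∸⟩ P))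
  where
  is-≡ : ∀ m n → (m ∸ n ≡ᵇ 0) ∧ (n ∸ m ≡ᵇ 0) ≡ (m ≡ᵇ n)
  is-≡ zero    zero    = refl
  is-≡ zero    (suc n) = refl
  is-≡ (suc m) zero    = refl
  is-≡ (suc m) (suc n) = is-≡ m n

-- The reduction

data Kind : Set where
  cell row col : Kind

Node : Set
Node = Kind × (ℕ × ℕ) × (ℕ × ℕ)

transpose : Node → Node
transpose (cell , (a , b) , (u , v)) = cell , (b , a) , (v , u)
transpose (row  , (a , b) , w)       = col  , (b , a) , w
transpose (col  , (a , b) , w)       = row  , (b , a) , w

byKind : ∀ {A : Set} → Kind → A → A → A → A
byKind cell x y z = x
byKind row  x y z = y
byKind col  x y z = z

rank : Kind → ℕ
rank κ = byKind κ 0 1 2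

isSame : Node → Node → Bool
isSame (κ , (a , b) , (u , v)) (κ′ , (a′ , b′) , (u′ , v′)) =
  (rank κ ≡ᵇ rank κ′) ∧ (a ≡ᵇ a′) ∧ (b ≡ᵇ b′) ∧ (u ≡ᵇ u′) ∧ (v ≡ᵇ v′)

isClose : ℕ → ℕ → ℕ → Bool
isClose w s t = (s ≤ᵇ t + w) ∧ (t ≤ᵇ s + w)

-- On track 1 the interval of p starts at half p + offset p / unit.  With offsets
-- below unit, intervals at equal halves meet, and those at halves h and h + 1
-- meet iff the offset of the second is at most that of the first.  The t-th
-- cell, t = a * k + b, lies at half 2 t + 1 and its row dummies at 2 t; the
-- column dummies are parked beyond all of them, away from other cells.  Track 2
-- is track 1 of the transposed node.
module Layout (n k : ℕ) where

  unit : ℕ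
  unit = suc (n + n)

  half offset : Node → ℕ
  half (cell , (a , b) , _) = suc (2 * (a * k + b))
  half (row  , (a , b) , _) = 2 * (a * k + b)
  half (col  , (a , b) , _) = suc (2 * (k * k + (a * k + b)))
  offset (cell , _ , (u , _)) = suc (2 * u)
  offset (row  , _ , (r , _)) = 2 * r
  offset (col  , _ , _)       = 0

  start : Node → ℕ
  start p = half p * unit + offset p

  joined : Node → Node → Bool
  joined p q = isClose unit (start p) (start q) ∨
               isClose unit (start (transpose p)) (start (transpose q))

  module Selection (adj : ℕ → ℕ → Bool) where

    -- At the beginning of a row or column only the dummy r = n remains, which
    -- sees all pairs of its own cell and none of the preceding cell.  Dummies
    -- do not use their last component z.
    isValid : Node → Bool
    isValid (cell , (a , b) , (u , v)) =
      (suc u ≤ᵇ n) ∧ (suc v ≤ᵇ n) ∧ (if a ≡ᵇ b then u ≡ᵇ v else adj u v)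
    isValid (row  , (a , b) , (r , z)) = (z ≡ᵇ 0) ∧ (not (b ≡ᵇ 0) ∨ (r ≡ᵇ n))
    isValid (col  , (a , b) , (r , z)) = (z ≡ᵇ 0) ∧ (not (a ≡ᵇ 0) ∨ (r ≡ᵇ n))

    nodes : List Node
    nodes = filterᵇ isValid
      (cartesianProduct (cell ∷ row ∷ col ∷ [])
        (cartesianProduct (cartesianProduct (upTo k) (upTo k))
                          (cartesianProduct (upTo (suc n)) (upTo (suc n)))))

-- The defaults `[]` and `false` are both encoded by `leaf`, as `headᵖ` demands.
entry : List (List Bool) → ℕ → ℕ → Bool
entry M u v = headOr false (drop v (headOr [] (drop u M)))

-- A kind is stored as two flags, for `row` and for `col`, so that one projection decides each test
-- in `byKindᵖ`.
Kindᵗ Nodeᵗ Inputᵗ : Type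
Kindᵗ  = type Kind λ where
  cell → node (encodeBool false) (encodeBool false)
  row  → node (encodeBool true)  (encodeBool false)
  col  → node (encodeBool false) (encodeBool true)
Nodeᵗ  = Kindᵗ ⊗ (ℕᵗ ⊗ ℕᵗ) ⊗ (ℕᵗ ⊗ ℕᵗ)
Inputᵗ = Listᵗ (Listᵗ 𝔹) ⊗ ℕᵗ

byKindᵖ : ∀ {κ f g h} → PolyTime Γ Kindᵗ κ →
          PolyTime Γ A f → PolyTime Γ A g → PolyTime Γ A h →
          PolyTime Γ A (λ γ → byKind (κ γ) (f γ) (g γ) (h γ))
byKindᵖ {κ = κ} {f} {g} {h} K P Q R =
  extensional eq (conditional (isRowᵖ ∙ K) Q (conditional (isColᵖ ∙ K) R P))
  where
  isRow isCol : Kind → Bool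
  isRow κ = byKind κ false true false
  isCol κ = byKind κ false false true
  isRowᵖ : PolyTime Kindᵗ 𝔹 isRow
  isRowᵖ = viaLeft λ { cell → refl ; row → refl ; col → refl }
  isColᵖ : PolyTime Kindᵗ 𝔹 isCol
  isColᵖ = viaRight λ { cell → refl ; row → refl ; col → refl }
  eq : ∀ γ → (if isRow (κ γ) then g γ else if isCol (κ γ) then h γ else f γ) ≡ byKind (κ γ) (f γ) (g γ) (h γ)
  eq γ with κ γ
  ... | cell = refl
  ... | row  = refl
  ... | col  = refl

entryᵖ : ∀ {M u v} → PolyTime Γ (Listᵗ (Listᵗ 𝔹)) M → PolyTime Γ ℕᵗ u → PolyTime Γ ℕᵗ v →
         PolyTime Γ 𝔹 (λ γ → entry (M γ) (u γ) (v γ))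
entryᵖ P Q R = headᵖ refl ∙ dropᵖ R (headᵖ refl ∙ dropᵖ Q P)

isSameᵖ : ∀ {p q} → PolyTime Γ Nodeᵗ p → PolyTime Γ Nodeᵗ q → PolyTime Γ 𝔹 (λ γ → isSame (p γ) (q γ))
isSameᵖ P Q = (rankᵖ ∙ first ∙ P ⟨≡⟩ rankᵖ ∙ first ∙ Q) ⟨∧⟩
  (first ∙ first ∙ second ∙ P ⟨≡⟩ first ∙ first ∙ second ∙ Q) ⟨∧⟩
  (second ∙ first ∙ second ∙ P ⟨≡⟩ second ∙ first ∙ second ∙ Q) ⟨∧⟩
  (first ∙ second ∙ second ∙ P ⟨≡⟩ first ∙ second ∙ second ∙ Q) ⟨∧⟩
  (second ∙ second ∙ second ∙ P ⟨≡⟩ second ∙ second ∙ second ∙ Q)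
  where
  rankᵖ : PolyTime Kindᵗ ℕᵗ rank
  rankᵖ = byKindᵖ identity (constant 0) (constant 1) (constant 2)

isCloseᵖ : ∀ {w s t} → PolyTime Γ ℕᵗ w → PolyTime Γ ℕᵗ s → PolyTime Γ ℕᵗ t →
           PolyTime Γ 𝔹 (λ γ → isClose (w γ) (s γ) (t γ))
isCloseᵖ W P Q = (P ⟨≤⟩ Q ⟨+⟩ W) ⟨∧⟩ (Q ⟨≤⟩ P ⟨+⟩ W)

module _ {n k : Carrier Γ → ℕ} (N : PolyTime Γ ℕᵗ n) (K : PolyTime Γ ℕᵗ k) where

  unitᵖ : PolyTime Γ ℕᵗ (λ γ → Layout.unit (n γ) (k γ))
  unitᵖ = sucᵖ ∙ (N ⟨+⟩ N)

  module _ {p : Carrier Γ → Node} (P : PolyTime Γ Nodeᵗ p) where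
    private
      kind = first ∙ P
      a    = first ∙ first ∙ second ∙ P
      b    = second ∙ first ∙ second ∙ P
      u    = first ∙ second ∙ second ∙ P

    transposeᵖ : PolyTime Γ Nodeᵗ (λ γ → transpose (p γ))
    transposeᵖ = extensional (λ γ → eq (p γ))
      (byKindᵖ kind (constant cell) (constant col) (constant row) & (b & a) &
       byKindᵖ kind (second ∙ second ∙ second ∙ P & u) (second ∙ second ∙ P) (second ∙ second ∙ P))
      where
      eq : ∀ ((κ , (a , b) , w@(u , v)) : Node) →
           (byKind κ cell col row , (b , a) , byKind κ (v , u) w w) ≡ transpose (κ , (a , b) , w)
      eq (cell , _) = refl
      eq (row  , _) = refl
      eq (col  , _) = refl

    startᵖ : PolyTime Γ ℕᵗ (λ γ → Layout.start (n γ) (k γ) (p γ))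
    startᵖ = extensional (λ γ → eq (n γ) (k γ) (p γ))
      (byKindᵖ kind (sucᵖ ∙ (constant 2 ⟨*⟩ t)) (constant 2 ⟨*⟩ t)
         (sucᵖ ∙ (constant 2 ⟨*⟩ (K ⟨*⟩ K ⟨+⟩ t))) ⟨*⟩ unitᵖ
       ⟨+⟩ byKindᵖ kind (sucᵖ ∙ (constant 2 ⟨*⟩ u)) (constant 2 ⟨*⟩ u) (constant 0))
      where
      t = a ⟨*⟩ K ⟨+⟩ b
      eq : ∀ n k ((κ , (a , b) , (u , v)) : Node) →
           byKind κ (suc (2 * (a * k + b))) (2 * (a * k + b)) (suc (2 * (k * k + (a * k + b)))) *
             Layout.unit n k + byKind κ (suc (2 * u)) (2 * u) 0 ≡
           Layout.start n k (κ , (a , b) , (u , v))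
      eq n k (cell , _) = refl
      eq n k (row  , _) = refl
      eq n k (col  , _) = refl

    module _ {M} (G : PolyTime Γ (Listᵗ (Listᵗ 𝔹)) M) where
      isValidᵖ : PolyTime Γ 𝔹 (λ γ → Layout.Selection.isValid (n γ) (k γ) (entry (M γ)) (p γ))
      isValidᵖ = extensional (λ γ → eq (n γ) (k γ) (M γ) (p γ))
        (byKindᵖ kind
          ((sucᵖ ∙ u ⟨≤⟩ N) ⟨∧⟩ (sucᵖ ∙ v ⟨≤⟩ N) ⟨∧⟩ conditional (a ⟨≡⟩ b) (u ⟨≡⟩ v) (entryᵖ G u v))
          (dummy b) (dummy a))
        where
        v = second ∙ second ∙ second ∙ P
        dummy : ∀ {c} → PolyTime Γ ℕᵗ c → PolyTime Γ 𝔹 _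
        dummy c = isZeroᵖ ∙ v ⟨∧⟩ ((⟨not⟩ isZeroᵖ ∙ c) ⟨∨⟩ (u ⟨≡⟩ N))
        eq : ∀ n k M ((κ , (a , b) , (u , v)) : Node) →
             byKind κ
               ((suc u ≤ᵇ n) ∧ (suc v ≤ᵇ n) ∧ (if a ≡ᵇ b then u ≡ᵇ v else entry M u v))
               ((v ≡ᵇ 0) ∧ (not (b ≡ᵇ 0) ∨ (u ≡ᵇ n)))
               ((v ≡ᵇ 0) ∧ (not (a ≡ᵇ 0) ∨ (u ≡ᵇ n))) ≡
             Layout.Selection.isValid n k (entry M) (κ , (a , b) , (u , v))
        eq n k M (cell , _) = refl
        eq n k M (row  , _) = refl
        eq n k M (col  , _) = refl

  module _ {p q : Carrier Γ → Node} (P : PolyTime Γ Nodeᵗ p) (Q : PolyTime Γ Nodeᵗ q) where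

    joinedᵖ : PolyTime Γ 𝔹 (λ γ → Layout.joined (n γ) (k γ) (p γ) (q γ))
    joinedᵖ = isCloseᵖ unitᵖ (startᵖ P) (startᵖ Q) ⟨∨⟩
              isCloseᵖ unitᵖ (startᵖ (transposeᵖ P)) (startᵖ (transposeᵖ Q))

-- A fraction is ((sign , numerator) , denominator − 1), as in encodeℚ; the
-- denominator is unit = n + n + 1 throughout.
Fractionᵗ Outputᵗ : Type
Fractionᵗ = (𝔹 ⊗ ℕᵗ) ⊗ ℕᵗ
Outputᵗ   = (Listᵗ (Listᵗ 𝔹) ⊗ Listᵗ (Fractionᵗ ⊗ Fractionᵗ)) ⊗ ℕᵗ

-- The output as plain lists without proofs, within reach of the combinators; `encode-output` shows
-- that its tree is that of the interval graph together with k².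
module Output (M : List (List Bool)) (k : ℕ) where
  n = length M
  open Layout n k
  open Selection (entry M) public

  adjacency : List (List Bool)
  adjacency = map (λ p → map (λ q → not (isSame p q) ∧ joined p q) nodes) nodes

  intervals : List (Carrier (Fractionᵗ ⊗ Fractionᵗ))
  intervals = map (λ p → ((false , start p) , n + n) , ((false , start (transpose p)) , n + n)) nodes

  output : Carrier Outputᵗ
  output = (adjacency , intervals) , k * k

outputᵖ : PolyTime Inputᵗ Outputᵗ (λ (M , k) → Output.output M k)
outputᵖ = (mapᵖ (mapᵖ (⟨not⟩ isSameᵖ p″ q″ ⟨∧⟩ joinedᵖ n″ k″ p″ q″) (nodesᵖ ∙ second)) nodesᵖ
  & mapᵖ (((constant false & startᵖ n′ k′ first) & n′ ⟨+⟩ n′)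
        & ((constant false & startᵖ n′ k′ (transposeᵖ n′ k′ first)) & n′ ⟨+⟩ n′)) nodesᵖ)
  & second ⟨*⟩ second
  where
  n′ : PolyTime (Nodeᵗ ⊗ Inputᵗ) ℕᵗ _
  n′ = lengthᵖ ∙ first ∙ second
  k′ : PolyTime (Nodeᵗ ⊗ Inputᵗ) ℕᵗ _
  k′ = second ∙ second
  n″ : PolyTime (Nodeᵗ ⊗ Nodeᵗ ⊗ Inputᵗ) ℕᵗ _
  n″ = n′ ∙ second
  k″ : PolyTime (Nodeᵗ ⊗ Nodeᵗ ⊗ Inputᵗ) ℕᵗ _
  k″ = k′ ∙ second
  p″ q″ : PolyTime (Nodeᵗ ⊗ Nodeᵗ ⊗ Inputᵗ) Nodeᵗ _
  p″ = first ∙ second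
  q″ = first
  nodesᵖ : PolyTime Inputᵗ (Listᵗ Nodeᵗ) (λ (M , k) → Output.nodes M k)
  nodesᵖ = filterᵖ (isValidᵖ n′ k′ first (first ∙ second))
    (constant (cell ∷ row ∷ col ∷ []) ⟨×⟩
      ((upToᵖ ∙ second ⟨×⟩ upToᵖ ∙ second) ⟨×⟩
       (upToᵖ ∙ sucᵖ ∙ lengthᵖ ∙ first ⟨×⟩ upToᵖ ∙ sucᵖ ∙ lengthᵖ ∙ first)))

-- Geometry of the two tracks

Close : ℕ → ℕ → ℕ → Set
Close w s t = s ≤ t + w × t ≤ s + w

isClose⇔Close : ∀ w s t → T (isClose w s t) ⇔ Close w s t
isClose⇔Close w s t = mk⇔
  (Product.map (≤ᵇ⇒≤ s (t + w)) (≤ᵇ⇒≤ t (s + w)) ∘ to T-∧)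
  (from T-∧ ∘ Product.map ≤⇒≤ᵇ ≤⇒≤ᵇ)

Contact : ℕ × ℕ → ℕ × ℕ → Set
Contact (h , x) (h′ , x′) = h ≡ h′ ⊎ (h′ ≡ suc h × x′ ≤ x) ⊎ (h ≡ suc h′ × x ≤ x′)

module _ {w : ℕ} where

  private
    -- If `h′` were at least h + 2, the second start would be at least h * w + 2 * w, which exceeds
    -- h * w + x + w because `x < w`.
    ahead : ∀ {h x h′ x′} → x < w → h < h′ → h′ * w + x′ ≤ h * w + x + w → h′ ≡ suc h × x′ ≤ x
    ahead {h} {x} {h′} {x′} x<w h<h′ le with ≤⇒≤′ h<h′
    ... | ≤′-refl = refl , +-cancelˡ-≤ (suc h * w) x′ x (begin
      suc h * w + x′     ≤⟨ le ⟩
      h * w + x + w      ≡⟨ +-comm _ w ⟩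
      w + (h * w + x)    ≡⟨ sym (+-assoc w (h * w) x) ⟩
      suc h * w + x      ∎)
      where open ≤-Reasoning
    ... | ≤′-step {h″} h<h″ = contradiction le (<⇒≱ (begin-strict
      h * w + x + w      <⟨ +-monoˡ-< w (+-monoʳ-< (h * w) x<w) ⟩
      h * w + w + w      ≡⟨ cong (_+ w) (+-comm (h * w) w) ⟩
      suc h * w + w      ≤⟨ +-monoˡ-≤ w (*-monoˡ-≤ w (≤′⇒≤ h<h″)) ⟩
      h″ * w + w         ≡⟨ +-comm (h″ * w) w ⟩
      suc h″ * w         ≤⟨ m≤m+n _ x′ ⟩
      suc h″ * w + x′    ∎))
      where open ≤-Reasoning

    near : ∀ h {x x′} → x < w → h * w + x ≤ h * w + x′ + w
    near h {x} {x′} x<w = begin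
      h * w + x          ≤⟨ +-monoʳ-≤ (h * w) (<⇒≤ x<w) ⟩
      h * w + w          ≤⟨ +-monoˡ-≤ w (m≤m+n (h * w) x′) ⟩
      h * w + x′ + w     ∎
      where open ≤-Reasoning

    next : ∀ h {x x′} → x < w → x′ ≤ x → Close w (h * w + x) (suc h * w + x′)
    next h {x} {x′} x<w x′≤x =
      (begin
        h * w + x           ≤⟨ +-monoʳ-≤ (h * w) (<⇒≤ x<w) ⟩
        h * w + w           ≤⟨ +-monoˡ-≤ w (≤-trans (m≤n+m (h * w) w) (m≤m+n _ x′)) ⟩
        suc h * w + x′ + w  ∎) ,
      (begin
        suc h * w + x′      ≤⟨ +-monoʳ-≤ (suc h * w) x′≤x ⟩
        suc h * w + x       ≡⟨ +-assoc w (h * w) x ⟩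
        w + (h * w + x)     ≡⟨ +-comm w _ ⟩
        h * w + x + w       ∎)
      where open ≤-Reasoning

  Close⇔Contact : ∀ {h x h′ x′} → x < w → x′ < w →
                  Close w (h * w + x) (h′ * w + x′) ⇔ Contact (h , x) (h′ , x′)
  Close⇔Contact {h} {x} {h′} {x′} x<w x′<w = mk⇔ forth back
    where
    forth : Close w (h * w + x) (h′ * w + x′) → Contact (h , x) (h′ , x′)
    forth (le , ge) with <-cmp h h′
    ... | tri< h<h′ _ _ = inj₂ (inj₁ (ahead x<w h<h′ ge))
    ... | tri≈ _ h≡h′ _ = inj₁ h≡h′
    ... | tri> _ _ h′<h = inj₂ (inj₂ (ahead x′<w h′<h le))
    back : Contact (h , x) (h′ , x′) → Close w (h * w + x) (h′ * w + x′)
    back (inj₁ refl)                = near h x<w , near h x′<w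
    back (inj₂ (inj₁ (refl , x′≤x))) = next h x<w x′≤x
    back (inj₂ (inj₂ (refl , x≤x′))) = let p , q = next h′ x′<w x≤x′ in q , p

-- Cells have odd offsets and row dummies even ones. Comparing them hence never ends in a tie, and
-- decides between u < r and r ≤ u.
2*m≤1+2*n⇒m≤n : ∀ {m n} → 2 * m ≤ suc (2 * n) → m ≤ n
2*m≤1+2*n⇒m≤n {m} {n} le = ≮⇒≥ λ n<m → <⇒≱ (begin-strict
  suc (2 * n)    <⟨ ≤-refl ⟩
  2 + 2 * n      ≡⟨ sym (*-suc 2 n) ⟩
  2 * suc n      ≤⟨ *-monoʳ-≤ 2 n<m ⟩
  2 * m          ∎) le
  where open ≤-Reasoning

1+2*m≤2*n⇒m<n : ∀ {m n} → suc (2 * m) ≤ 2 * n → m < n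
1+2*m≤2*n⇒m<n {m} {n} le = ≰⇒> λ n≤m → <⇒≱ (s≤s (*-monoʳ-≤ 2 n≤m)) le

m<n⇒1+2*m≤2*n : ∀ {m n} → m < n → suc (2 * m) ≤ 2 * n
m<n⇒1+2*m≤2*n {m} {n} m<n = begin
  suc (2 * m)   ≤⟨ n≤1+n _ ⟩
  2 + 2 * m     ≡⟨ sym (*-suc 2 m) ⟩
  2 * suc m     ≤⟨ *-monoʳ-≤ 2 m<n ⟩
  2 * n         ∎
  where open ≤-Reasoning

module _ {k : ℕ} where

  digits-< : ∀ {a b a′} b′ → b < k → a < a′ → a * k + b < a′ * k + b′
  digits-< {a} {b} {a′} b′ b<k a<a′ = begin-strict
    a * k + b      <⟨ +-monoʳ-< (a * k) b<k ⟩
    a * k + k      ≡⟨ +-comm (a * k) k ⟩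
    suc a * k      ≤⟨ *-monoˡ-≤ k a<a′ ⟩
    a′ * k         ≤⟨ m≤m+n _ b′ ⟩
    a′ * k + b′    ∎
    where open ≤-Reasoning

  digits-injective : ∀ {a b a′ b′} → b < k → b′ < k → a * k + b ≡ a′ * k + b′ → (a , b) ≡ (a′ , b′)
  digits-injective {a} {b} {a′} {b′} b<k b′<k eq with <-cmp a a′
  ... | tri< a<a′ _ _ = contradiction eq (<⇒≢ (digits-< b′ b<k a<a′))
  ... | tri≈ _ refl _ = cong (a ,_) (+-cancelˡ-≡ (a * k) b b′ eq)
  ... | tri> _ _ a′<a = contradiction (sym eq) (<⇒≢ (digits-< b b′<k a′<a))

  digits-<-square : ∀ {a b} → a < k → b < k → a * k + b < k * k
  digits-<-square {a} {b} a<k b<k = ≤-trans (digits-< 0 b<k a<k) (≤-reflexive (+-identityʳ (k * k)))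

module Geometry (n k : ℕ) where
  open Layout n k

  data Near (p q : Node) : Set where
    track₁ : Close unit (start p) (start q) → Near p q
    track₂ : Close unit (start (transpose p)) (start (transpose q)) → Near p q

  joined⇔Near : ∀ p q → T (joined p q) ⇔ Near p q
  joined⇔Near p q = mk⇔
    (λ t → case to T-∨ t of λ where
      (inj₁ c) → track₁ (to first⇔ c)
      (inj₂ c) → track₂ (to second⇔ c))
    (λ where
      (track₁ c) → from T-∨ (inj₁ (from first⇔ c))
      (track₂ c) → from T-∨ (inj₂ (from second⇔ c)))
    where
    first⇔  = isClose⇔Close unit (start p) (start q)
    second⇔ = isClose⇔Close unit (start (transpose p)) (start (transpose q))

  Range : Node → Set
  Range (cell , (a , b) , (u , v)) = a < k × b < k × u < n × v < n
  Range (_    , (a , b) , (r , _)) = a < k × b < k × r ≤ n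

  -- `Range` computes on the kind; the record wrapper keeps `p` recoverable by unification.
  record InRange (p : Node) : Set where
    constructor inRange
    field
      range : Range p

  transpose-inRange : ∀ {p} → InRange p → InRange (transpose p)
  transpose-inRange {cell , _} (inRange (a< , b< , u< , v<)) = inRange (b< , a< , v< , u<)
  transpose-inRange {row  , _} (inRange (a< , b< , r≤))      = inRange (b< , a< , r≤)
  transpose-inRange {col  , _} (inRange (a< , b< , r≤))      = inRange (b< , a< , r≤)

  transpose-involutive : ∀ p → transpose (transpose p) ≡ p
  transpose-involutive (cell , _) = refl
  transpose-involutive (row  , _) = refl
  transpose-involutive (col  , _) = refl

  Near-transpose : ∀ {p q} → Near p q → Near (transpose p) (transpose q)
  Near-transpose {p} {q} (track₁ c) = track₂ (subst₂ (λ p q → Close unit (start p) (start q))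
    (sym (transpose-involutive p)) (sym (transpose-involutive q)) c)
  Near-transpose (track₂ c) = track₁ c

  Near-sym : ∀ {p q} → Near p q → Near q p
  Near-sym (track₁ (l , r)) = track₁ (r , l)
  Near-sym (track₂ (l , r)) = track₂ (r , l)

  Near-refl : ∀ p → Near p p
  Near-refl p = track₁ (m≤m+n _ _ , m≤m+n _ _)

  double : n + n ≡ 2 * n
  double = cong (n +_) (sym (+-identityʳ n))

  offset<unit : ∀ p → InRange p → offset p < unit
  offset<unit (cell , _) (inRange (_ , _ , u< , _)) = s≤s (≤-trans (m<n⇒1+2*m≤2*n u<) (≤-reflexive (sym double)))
  offset<unit (row  , _) (inRange (_ , _ , r≤))     = s≤s (≤-trans (*-monoʳ-≤ 2 r≤) (≤-reflexive (sym double)))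
  offset<unit (col  , _) _                = s≤s z≤n

  place : Node → ℕ × ℕ
  place p = half p , offset p

  close⇔contact : ∀ {p q} → InRange p → InRange q →
                  Close unit (start p) (start q) ⇔ Contact (place p) (place q)
  close⇔contact {p} {q} p∈ q∈ = Close⇔Contact (offset<unit p p∈) (offset<unit q q∈)

  index : ℕ × ℕ → ℕ
  index (a , b) = a * k + b

  private
    -- Consecutive halves differ in parity, so among halves of equal parity only equality gives
    -- contact. Across parities, equality is the excluded case instead.
    odds : ∀ m n {x y} → Contact (suc (2 * m) , x) (suc (2 * n) , y) → m ≡ n
    odds m n (inj₁ eq)              = *-cancelˡ-≡ m n 2 (suc-injective eq)
    odds m n (inj₂ (inj₁ (eq , _))) = ⊥-elim (even≢odd n m (suc-injective eq))
    odds m n (inj₂ (inj₂ (eq , _))) = ⊥-elim (even≢odd m n (suc-injective eq))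

    evens : ∀ m n {x y} → Contact (2 * m , x) (2 * n , y) → m ≡ n
    evens m n (inj₁ eq)              = *-cancelˡ-≡ m n 2 eq
    evens m n (inj₂ (inj₁ (eq , _))) = ⊥-elim (even≢odd n m eq)
    evens m n (inj₂ (inj₂ (eq , _))) = ⊥-elim (even≢odd m n eq)

    even-odd : ∀ m n {x y} → Contact (2 * m , x) (suc (2 * n) , y) →
               (m ≡ n × y ≤ x) ⊎ (m ≡ suc n × x ≤ y)
    even-odd m n (inj₁ eq)               = ⊥-elim (even≢odd m n eq)
    even-odd m n (inj₂ (inj₁ (eq , y≤))) = inj₁ (*-cancelˡ-≡ m n 2 (sym (suc-injective eq)) , y≤)
    even-odd m n (inj₂ (inj₂ (eq , x≤))) = inj₂ (*-cancelˡ-≡ m (suc n) 2 (trans eq (sym (*-suc 2 n))) , x≤)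

    beyond : ∀ {t t′} → t < k * k → t ≢ k * k + t′
    beyond {t} {t′} t< refl = <⇒≱ t< (m≤m+n (k * k) t′)

    close-cells : ∀ {i i′ w w′} → InRange (cell , i , w) → InRange (cell , i′ , w′) →
                  Close unit (start (cell , i , w)) (start (cell , i′ , w′)) → i ≡ i′
    close-cells p∈@(inRange (_ , b< , _)) q∈@(inRange (_ , b′< , _)) c =
      digits-injective b< b′< (odds _ _ (to (close⇔contact p∈ q∈) c))

  near-cells : ∀ {i i′ w w′} → InRange (cell , i , w) → InRange (cell , i′ , w′) →
               Near (cell , i , w) (cell , i′ , w′) → i ≡ i′
  near-cells p∈ q∈ (track₁ c) = close-cells p∈ q∈ c
  near-cells p∈ q∈ (track₂ c) =
    cong (λ (a , b) → b , a) (close-cells (transpose-inRange p∈) (transpose-inRange q∈) c)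

  near-same-cell : ∀ {i w w′} → InRange (cell , i , w) → InRange (cell , i , w′) →
                   Near (cell , i , w) (cell , i , w′)
  near-same-cell p∈ q∈ = track₁ (from (close⇔contact p∈ q∈) (inj₁ refl))

  near-rows : ∀ {i i′ w w′} → InRange (row , i , w) → InRange (row , i′ , w′) →
              Near (row , i , w) (row , i′ , w′) → i ≡ i′
  near-rows p∈@(inRange (_ , b< , _)) q∈@(inRange (_ , b′< , _)) (track₁ c) =
    digits-injective b< b′< (evens _ _ (to (close⇔contact p∈ q∈) c))
  near-rows p∈@(inRange (a< , _)) q∈@(inRange (a′< , _)) (track₂ c) =
    cong (λ (a , b) → b , a) (digits-injective a< a′< (+-cancelˡ-≡ (k * k) _ _
      (odds _ _ (to (close⇔contact (transpose-inRange p∈) (transpose-inRange q∈)) c))))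

  near-same-row : ∀ {i w w′} → InRange (row , i , w) → InRange (row , i , w′) →
                  Near (row , i , w) (row , i , w′)
  near-same-row p∈ q∈ = track₁ (from (close⇔contact p∈ q∈) (inj₁ refl))

  private
    ¬close-row-col : ∀ {i i′ w w′} → InRange (row , i , w) → InRange (col , i′ , w′) →
                     ¬ Close unit (start (row , i , w)) (start (col , i′ , w′))
    ¬close-row-col p∈@(inRange (a< , b< , _)) q∈ c with even-odd _ _ (to (close⇔contact p∈ q∈) c)
    ... | inj₁ (eq , _) = beyond (digits-<-square a< b<) eq
    ... | inj₂ (eq , _) = beyond (digits-<-square a< b<) (trans eq (sym (+-suc (k * k) _)))

    ¬close-col-cell : ∀ {i i′ w w′} → InRange (col , i , w) → InRange (cell , i′ , w′) →
                      ¬ Close unit (start (col , i , w)) (start (cell , i′ , w′))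
    ¬close-col-cell p∈ q∈@(inRange (a< , b< , _)) c =
      beyond (digits-<-square a< b<) (sym (odds _ _ (to (close⇔contact p∈ q∈) c)))

  -- On track 1 the column dummy is parked beyond the row dummies, and on track 2 the roles are
  -- exchanged.
  ¬near-row-col : ∀ {i i′ w w′} → InRange (row , i , w) → InRange (col , i′ , w′) →
                  ¬ Near (row , i , w) (col , i′ , w′)
  ¬near-row-col p∈ q∈ (track₁ c) = ¬close-row-col p∈ q∈ c
  ¬near-row-col p∈ q∈ (track₂ (l , r)) =
    ¬close-row-col (transpose-inRange q∈) (transpose-inRange p∈) (r , l)

  Sees : ℕ × ℕ → ℕ → ℕ × ℕ → ℕ → Set
  Sees i r i′ u = (i ≡ i′ × u < r) ⊎ (index i ≡ suc (index i′) × r ≤ u)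

  near-row-cell : ∀ {i i′ r z u v} → InRange (row , i , r , z) → InRange (cell , i′ , u , v) →
                  Near (row , i , r , z) (cell , i′ , u , v) → Sees i r i′ u
  near-row-cell p∈@(inRange (_ , b< , _)) q∈@(inRange (_ , b′< , _)) (track₁ c) =
    Sum.map (λ (eq , le) → digits-injective b< b′< eq , 1+2*m≤2*n⇒m<n le)
            (λ (eq , le) → eq , 2*m≤1+2*n⇒m≤n le)
            (even-odd _ _ (to (close⇔contact p∈ q∈) c))
  near-row-cell p∈ q∈ (track₂ c) =
    ⊥-elim (¬close-col-cell (transpose-inRange p∈) (transpose-inRange q∈) c)

  sees⇒near : ∀ {i i′ r z u v} → InRange (row , i , r , z) → InRange (cell , i′ , u , v) →
              Sees i r i′ u → Near (row , i , r , z) (cell , i′ , u , v)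
  sees⇒near p∈ q∈ (inj₁ (refl , u<r)) = track₁ (from (close⇔contact p∈ q∈) (inj₂ (inj₁ (refl , m<n⇒1+2*m≤2*n u<r))))
  sees⇒near {i} {i′} p∈ q∈ (inj₂ (eq , r≤u)) = track₁ (from (close⇔contact p∈ q∈)
    (inj₂ (inj₂ (trans (cong (2 *_) eq) (*-suc 2 (index i′)) , ≤-trans (*-monoʳ-≤ 2 r≤u) (n≤1+n _)))))

-- Cliques and perfect codes in the grid

module Grid (n k : ℕ) (adj : ℕ → ℕ → Bool) where
  open Layout n k public
  open Selection adj public
  open Geometry n k public

  Allowed : Node → Set
  Allowed (cell , (a , b) , (u , v)) = T (if a ≡ᵇ b then u ≡ᵇ v else adj u v)
  Allowed (row  , (a , b) , (r , z)) = z ≡ 0 × (b ≢ 0 ⊎ r ≡ n)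
  Allowed (col  , (a , b) , (r , z)) = z ≡ 0 × (a ≢ 0 ⊎ r ≡ n)

  record Valid (p : Node) : Set where
    constructor valid
    field
      isInRange : InRange p
      allowed  : Allowed p

  open Valid public

  candidates : List Node
  candidates = cartesianProduct (cell ∷ row ∷ col ∷ [])
    (cartesianProduct (cartesianProduct (upTo k) (upTo k))
                      (cartesianProduct (upTo (suc n)) (upTo (suc n))))

  nodes-unique : Unique nodes
  nodes-unique = Unique.filter⁺ (T? ∘ isValid) (Unique.cartesianProduct⁺ {xs = cell ∷ row ∷ col ∷ []} kinds
    (Unique.cartesianProduct⁺ (Unique.cartesianProduct⁺ (Unique.upTo⁺ k) (Unique.upTo⁺ k))
                              (Unique.cartesianProduct⁺ (Unique.upTo⁺ (suc n)) (Unique.upTo⁺ (suc n)))))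
    where
    kinds : Unique (cell ∷ row ∷ col ∷ [])
    kinds = ((λ ()) ∷ (λ ()) ∷ []) ∷ ((λ ()) ∷ []) ∷ [] ∷ []

  private
    not-zero : ∀ {a} → T (not (a ≡ᵇ 0)) ⇔ a ≢ 0
    not-zero {zero}  = mk⇔ (λ ()) (λ ne → ne refl)
    not-zero {suc a} = mk⇔ (λ _ ()) (λ _ → _)

    dummy⇔ : ∀ {a r z} → T ((z ≡ᵇ 0) ∧ (not (a ≡ᵇ 0) ∨ (r ≡ᵇ n))) ⇔ (z ≡ 0 × (a ≢ 0 ⊎ r ≡ n))
    dummy⇔ {a} {r} {z} = mk⇔
      (λ t → let l , m = to T-∧ t in
        ≡ᵇ⇒≡ z 0 l , Sum.map (to (not-zero {a})) (≡ᵇ⇒≡ r n) (to T-∨ m))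
      (λ (l , m) → from T-∧ (≡⇒≡ᵇ z 0 l , from T-∨ (Sum.map (from (not-zero {a})) (≡⇒≡ᵇ r n) m)))

    candidate⁻ : ∀ {κ a b u v} → (κ , (a , b) , (u , v)) ∈ˡ candidates →
                 a < k × b < k × u ≤ n × v ≤ n
    candidate⁻ p∈ =
      let _ , ij∈ = ∈-cartesianProduct⁻ (cell ∷ row ∷ col ∷ []) _ p∈
          i∈ , j∈ = ∈-cartesianProduct⁻ (cartesianProduct (upTo k) (upTo k)) _ ij∈
          a∈ , b∈ = ∈-cartesianProduct⁻ (upTo k) _ i∈
          u∈ , v∈ = ∈-cartesianProduct⁻ (upTo (suc n)) _ j∈
      in ∈-upTo⁻ a∈ , ∈-upTo⁻ b∈ , s≤s⁻¹ (∈-upTo⁻ u∈) , s≤s⁻¹ (∈-upTo⁻ v∈)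

    candidate⁺ : ∀ {κ a b u v} → a < k → b < k → u ≤ n → v ≤ n →
                 (κ , (a , b) , (u , v)) ∈ˡ candidates
    candidate⁺ {κ} a< b< u≤ v≤ = ∈-cartesianProduct⁺ (kind∈ κ)
      (∈-cartesianProduct⁺ (∈-cartesianProduct⁺ (∈-upTo⁺ a<) (∈-upTo⁺ b<))
                           (∈-cartesianProduct⁺ (∈-upTo⁺ (s≤s u≤)) (∈-upTo⁺ (s≤s v≤))))
      where
      kind∈ : ∀ κ → κ ∈ˡ (cell ∷ row ∷ col ∷ [])
      kind∈ cell = here refl
      kind∈ row  = there (here refl)
      kind∈ col  = there (there (here refl))

  ∈nodes⇒valid : ∀ {p} → p ∈ˡ nodes → Valid p
  ∈nodes⇒valid {p} p∈ with ∈-filter⁻ (T? ∘ isValid) {xs = candidates} p∈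
  ∈nodes⇒valid {cell , _} p∈ | c , t =
    let a< , b< , _ = candidate⁻ c
        u< , t′ = to T-∧ t
        v< , al = to T-∧ t′
    in valid (inRange (a< , b< , ≤ᵇ⇒≤ _ n u< , ≤ᵇ⇒≤ _ n v<)) al
  ∈nodes⇒valid {row , (_ , b) , _} p∈ | c , t =
    let a< , b< , r≤ , _ = candidate⁻ c in valid (inRange (a< , b< , r≤)) (to (dummy⇔ {b}) t)
  ∈nodes⇒valid {col , (a , _) , _} p∈ | c , t =
    let a< , b< , r≤ , _ = candidate⁻ c in valid (inRange (a< , b< , r≤)) (to (dummy⇔ {a}) t)

  valid⇒∈nodes : ∀ {p} → Valid p → p ∈ˡ nodes
  valid⇒∈nodes {cell , _} (valid (inRange (a< , b< , u< , v<)) al) =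
    ∈-filter⁺ (T? ∘ isValid) (candidate⁺ a< b< (<⇒≤ u<) (<⇒≤ v<))
      (from T-∧ (≤⇒≤ᵇ u< , from T-∧ (≤⇒≤ᵇ v< , al)))
  valid⇒∈nodes {row , (_ , b) , _} (valid (inRange (a< , b< , r≤)) al@(refl , _)) =
    ∈-filter⁺ (T? ∘ isValid) (candidate⁺ a< b< r≤ z≤n) (from (dummy⇔ {b}) al)
  valid⇒∈nodes {col , (a , _) , _} (valid (inRange (a< , b< , r≤)) al@(refl , _)) =
    ∈-filter⁺ (T? ∘ isValid) (candidate⁺ a< b< r≤ z≤n) (from (dummy⇔ {a}) al)

  -- The induction only makes `a ≡ᵇ a` compute.
  allowed-diagonal : ∀ {a u v} → Allowed (cell , (a , a) , (u , v)) → u ≡ v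
  allowed-diagonal {zero}  al = ≡ᵇ⇒≡ _ _ al
  allowed-diagonal {suc a} al = allowed-diagonal {a} al

  diagonal-allowed : ∀ a u → Allowed (cell , (a , a) , (u , u))
  diagonal-allowed zero    u = ≡⇒≡ᵇ u u refl
  diagonal-allowed (suc a) u = diagonal-allowed a u

  allowed-off-diagonal : ∀ {a b u v} → a ≢ b → Allowed (cell , (a , b) , (u , v)) ⇔ T (adj u v)
  allowed-off-diagonal {zero}  {zero}  ne = contradiction refl ne
  allowed-off-diagonal {zero}  {suc b} ne = mk⇔ (λ x → x) (λ x → x)
  allowed-off-diagonal {suc a} {zero}  ne = mk⇔ (λ x → x) (λ x → x)
  allowed-off-diagonal {suc a} {suc b} ne = allowed-off-diagonal {a} {b} (ne ∘ cong suc)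

  module _ (adj-sym : ∀ {u v} → u < n → v < n → T (adj u v) → T (adj v u)) where

    transpose-valid : ∀ {p} → Valid p → Valid (transpose p)
    transpose-valid {row  , _} (valid p∈ al) = valid (transpose-inRange p∈) al
    transpose-valid {col  , _} (valid p∈ al) = valid (transpose-inRange p∈) al
    transpose-valid {cell , (a , b) , (u , v)} (valid p∈@(inRange (_ , _ , u< , v<)) al) =
      valid (transpose-inRange p∈) allowed′
      where
      allowed′ : Allowed (cell , (b , a) , (v , u))
      allowed′ with a ≟ b
      ... | yes refl with refl ← allowed-diagonal {a} al = al
      ... | no  a≢b  = from (allowed-off-diagonal (a≢b ∘ sym)) (adj-sym u< v< (to (allowed-off-diagonal a≢b) al))

  locate : ∀ {a} → a < k → ∃ λ (i : Fin k) → toℕ i ≡ a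
  locate a< = fromℕ< a< , toℕ-fromℕ< a<

  at : Fin k × Fin k → ℕ × ℕ
  at (i , j) = toℕ i , toℕ j

  at-injective : ∀ {c d} → at c ≡ at d → c ≡ d
  at-injective eq = cong₂ _,_ (toℕ-injective (cong proj₁ eq)) (toℕ-injective (cong proj₂ eq))

  predecessor : ∀ (j : Fin k) → toℕ j ≢ 0 → ∃ λ (j′ : Fin k) → toℕ j ≡ suc (toℕ j′)
  predecessor j j≢0 with toℕ j | toℕ<n j
  ... | zero  | _  = contradiction refl j≢0
  ... | suc b | b< = let j′ , eq = locate (<-trans (n<1+n b) b<) in j′ , cong suc (sym eq)

  index-preceding : ∀ {i j j′ : Fin k} → toℕ j ≡ suc (toℕ j′) → index (at (i , j)) ≡ suc (index (at (i , j′)))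
  index-preceding {i} {_} {j′} eq = trans (cong (toℕ i * k +_) eq) (+-suc (toℕ i * k) (toℕ j′))

  -- Indices run on from the end of one row to the start of the next; a positive `j` ensures that
  -- the step back stays in row `i`.
  preceding : ∀ {i j j′ : Fin k} → toℕ j ≡ suc (toℕ j′) → ∀ d → index (at (i , j)) ≡ suc (index (at d)) → d ≡ (i , j′)
  preceding {i} {_} {j′} j≡ (a , b) eq = at-injective (digits-injective (toℕ<n b) (toℕ<n j′)
    (suc-injective (trans (sym eq) (index-preceding {i} j≡))))

-- From a clique to a perfect code

module FromClique (n k : ℕ) (adj : ℕ → ℕ → Bool) (φ : Fin k → ℕ) (φ< : ∀ i → φ i < n)
                  (φ-adj : ∀ {i j} → i ≢ j → T (adj (φ i) (φ j))) where
  open Grid n k adj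

  choice : Fin k × Fin k → Node
  choice c@(i , j) = cell , at c , (φ i , φ j)

  choice-inRange : ∀ c → InRange (choice c)
  choice-inRange (i , j) = inRange (toℕ<n i , toℕ<n j , φ< i , φ< j)

  choice-valid : ∀ c → Valid (choice c)
  choice-valid (i , j) = valid (choice-inRange (i , j)) al
    where
    al : Allowed (choice (i , j))
    al with toℕ i ≟ toℕ j
    ... | yes eq with refl ← toℕ-injective eq = diagonal-allowed (toℕ i) (φ i)
    ... | no  ne = from (allowed-off-diagonal ne) (φ-adj λ { refl → ne refl })

  choice-injective : ∀ {c d} → choice c ≡ choice d → c ≡ d
  choice-injective eq = at-injective (cong (proj₁ ∘ proj₂) eq)

  Covers : Node → Fin k × Fin k → Set
  Covers p c = Near p (choice c) × (∀ d → Near p (choice d) → d ≡ c)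

  -- All choices in row `i` have first component `φ i`. If `φ i < r`, the own cell covers the dummy
  -- and a preceding cell of the row does not. Otherwise r ≤ φ i < n excludes `r ≡ n`, so `j` is
  -- positive and the cell before it in the row covers the dummy.
  row-covered : ∀ {i j r z} → Valid (row , at (i , j) , r , z) → ∃ (Covers (row , at (i , j) , r , z))
  row-covered {i} {j} {r} (valid p∈ (_ , al)) with φ i <? r
  ... | yes φ<r = (i , j) , sees⇒near p∈ (choice-inRange (i , j)) (inj₁ (refl , φ<r)) , only
    where
    only : ∀ d → Near _ (choice d) → d ≡ (i , j)
    only d near with near-row-cell p∈ (choice-inRange d) near
    ... | inj₁ (eq , _)  = at-injective (sym eq)
    ... | inj₂ (eq , r≤) = case al of λ where
      (inj₁ j≢0) → let j′ , j≡ = predecessor j j≢0 in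
        case preceding {i} j≡ d eq of λ { refl → contradiction r≤ (<⇒≱ φ<r) }
      -- Here the preceding cell may belong to another row, but no pair reaches first component n.
      (inj₂ r≡n) → contradiction (≤-trans (≤-reflexive (sym r≡n)) r≤) (<⇒≱ (φ< (proj₁ d)))
  ... | no φ≮r = (i , j′) , sees⇒near p∈ (choice-inRange (i , j′)) (inj₂ (index-preceding {i} j≡ , r≤)) , only
    where
    r≤ : r ≤ φ i
    r≤ = ≮⇒≥ φ≮r
    previous : ∃ λ j′ → toℕ j ≡ suc (toℕ j′)
    previous = predecessor j (case al of λ where
      (inj₁ j≢0) → j≢0
      (inj₂ r≡n) → contradiction (≤-trans (≤-reflexive (sym r≡n)) r≤) (<⇒≱ (φ< i)))
    j′ = proj₁ previous
    j≡ = proj₂ previous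
    only : ∀ d → Near _ (choice d) → d ≡ (i , j′)
    only d near with near-row-cell p∈ (choice-inRange d) near
    ... | inj₁ (eq , φ<r) = case at-injective eq of λ { refl → contradiction φ<r φ≮r }
    ... | inj₂ (eq , _)   = preceding {i} j≡ d eq

  covered : ∀ {p} → Valid p → ∃ (Covers p)
  covered {cell , _ , w} (valid p∈@(inRange (a< , b< , _)) _)
    with i , refl ← locate a< | j , refl ← locate b<
    = (i , j) , near-same-cell p∈ (choice-inRange (i , j)) ,
      λ d near → at-injective (sym (near-cells p∈ (choice-inRange d) near))
  covered {row , _ , w} p-valid@(valid (inRange (a< , b< , _)) _)
    with i , refl ← locate a< | j , refl ← locate b<
    = row-covered p-valid
  covered {col , _ , w} (valid p∈@(inRange (a< , b< , _)) al)
    with i , refl ← locate a< | j , refl ← locate b<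
    -- Both components of a choice come from the same `φ`, so transposing `choice (j , i)` gives
    -- `choice (i , j)` and the row case applies.
    = let c , near , only = row-covered {j} {i} (valid (transpose-inRange p∈) al) in
      swap c , Near-transpose near ,
      λ d near′ → cong swap (only (swap d) (Near-transpose near′))

-- From a perfect code to a clique

module FromCode (n k : ℕ) (adj : ℕ → ℕ → Bool)
  (adj-sym : ∀ {u v} → u < n → v < n → T (adj u v) → T (adj v u)) where
  open Grid n k adj

  -- The value r = n is valid in every cell, including the first of a row, and exceeds every `u`, so
  -- the guard never looks into the preceding cell.
  guard : ℕ × ℕ → Node
  guard i = row , i , (n , 0)

  -- Abstract in the selection so that the same argument, applied to the transposed code, treats the
  -- columns.
  module Rows (Sel : Node → Set) (sel-valid : ∀ {p} → Sel p → Valid p)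
    (perfect : ∀ {p} → Valid p → ∃ λ q → Sel q × Near p q × (∀ {q′} → Sel q′ → Near p q′ → q ≡ q′))
    where

    guard-inRange : ∀ {a b} → a < k → b < k → InRange (guard (a , b))
    guard-inRange a< b< = inRange (a< , b< , ≤-refl)

    guard-valid : ∀ {a b} → a < k → b < k → Valid (guard (a , b))
    guard-valid a< b< = valid (guard-inRange a< b<) (refl , inj₂ refl)

    cell-near-guard : ∀ {i w} → InRange (cell , i , w) → Near (guard i) (cell , i , w)
    cell-near-guard p∈@(inRange (a< , b< , u< , _)) = sees⇒near (guard-inRange a< b<) p∈ (inj₁ (refl , u<))

    data AtGuard (i : ℕ × ℕ) : Node → Set where
      at-cell : ∀ {w} → AtGuard i (cell , i , w)
      at-row  : ∀ {w} → AtGuard i (row , i , w)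

    near-guard : ∀ {a b q} → a < k → b < k → InRange q → Near (guard (a , b)) q → AtGuard (a , b) q
    near-guard {q = cell , _ , (u , _)} a< b< q∈@(inRange (_ , _ , u< , _)) near
      with near-row-cell (guard-inRange a< b<) q∈ near
    ... | inj₁ (refl , _) = at-cell
    ... | inj₂ (_ , n≤u)  = contradiction n≤u (<⇒≱ u<)
    near-guard {q = row , _} a< b< q∈ near with refl ← near-rows (guard-inRange a< b<) q∈ near = at-row
    near-guard {q = col , _} a< b< q∈ near = ⊥-elim (¬near-row-col (guard-inRange a< b<) q∈ near)

    unique-near : ∀ {p q q′} → Valid p → Sel q → Near p q → Sel q′ → Near p q′ → q ≡ q′
    unique-near p-valid s near s′ near′ =
      let _ , _ , _ , only = perfect p-valid in trans (sym (only s near)) (only s′ near′)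

    module Chosen (chosen : ∀ {a b} → a < k → b < k → ∃ λ w → Sel (cell , (a , b) , w)) where

      cell-unique : ∀ {i w w′} → Sel (cell , i , w) → Sel (cell , i , w′) → w ≡ w′
      cell-unique s s′ with isInRange (sel-valid s)
      ... | p∈@(inRange (a< , b< , _)) = cong (proj₂ ∘ proj₂)
        (unique-near (guard-valid a< b<) s (cell-near-guard p∈)
          s′ (cell-near-guard (isInRange (sel-valid s′))))

      no-row : ∀ {i w} → ¬ Sel (row , i , w)
      no-row s with isInRange (sel-valid s)
      ... | p∈@(inRange (a< , b< , _)) with chosen a< b<
      ... | _ , s′ = case unique-near (guard-valid a< b<) s (near-same-row (guard-inRange a< b<) p∈)
        s′ (cell-near-guard (isInRange (sel-valid s′))) of λ ()

      -- If u < u′, the dummy r = u′ of the later cell meets both pairs. If u′ < u, its dummy r = u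
      -- meets neither, and with all row dummies unselected nothing dominates it.
      step : ∀ {a b u v u′ v′} → Sel (cell , (a , suc b) , (u , v)) → Sel (cell , (a , b) , (u′ , v′)) → u ≡ u′
      step {a} {b} {u} {v} {u′} {v′} s s′ with isInRange (sel-valid s) | isInRange (sel-valid s′) | <-cmp u u′
      ... | _ | _ | tri≈ _ eq _ = eq
      ... | p∈@(inRange (a< , b< , u< , _)) | p′∈@(inRange (_ , _ , u′< , _)) | tri< u<u′ _ _ =
        case unique-near {row , (a , suc b) , (u′ , 0)} (valid r∈ (refl , inj₁ λ ()))
          s (sees⇒near r∈ p∈ (inj₁ (refl , u<u′)))
          s′ (sees⇒near r∈ p′∈ (inj₂ (+-suc (a * k) b , ≤-refl))) of λ ()
        where
        r∈ : InRange (row , (a , suc b) , (u′ , 0))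
        r∈ = inRange (a< , b< , <⇒≤ u′<)
      ... | p∈@(inRange (a< , b< , u< , _)) | p′∈@(inRange (_ , b′< , _)) | tri> _ _ u′<u =
        ⊥-elim (none (perfect {row , (a , suc b) , (u , 0)} (valid r∈ (refl , inj₁ λ ()))))
        where
        r∈ : InRange (row , (a , suc b) , (u , 0))
        r∈ = inRange (a< , b< , <⇒≤ u<)
        none : ¬ (∃ λ q → Sel q × Near (row , (a , suc b) , (u , 0)) q × _)
        none ((row , _) , sq , _) = no-row sq
        none ((col , _) , sq , near , _) = ¬near-row-col r∈ (isInRange (sel-valid sq)) near
        none ((cell , i , (x , y)) , sq , near , _) with near-row-cell r∈ (isInRange (sel-valid sq)) near
        ... | inj₁ (refl , x<u) with refl ← cell-unique s sq = <-irrefl refl x<u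
        ... | inj₂ (eq , u≤x) with isInRange (sel-valid sq)
        ... | inRange (_ , y< , _)
          with refl ← digits-injective {a = proj₁ i} {a′ = a} y< b′< (suc-injective (trans (sym eq) (+-suc (a * k) b)))
          with refl ← cell-unique s′ sq = <⇒≱ u′<u u≤x

      row-origin : ∀ {a u₀ v₀} b {u v} → Sel (cell , (a , 0) , (u₀ , v₀)) → Sel (cell , (a , b) , (u , v)) → u ≡ u₀
      row-origin zero    s₀ s = cong proj₁ (cell-unique s s₀)
      row-origin (suc b) s₀ s with isInRange (sel-valid s)
      ... | inRange (a< , b< , _) =
        let _ , s′ = chosen a< (<-trans (n<1+n b) b<) in trans (step s s′) (row-origin b s₀ s′)

      row-constant : ∀ {a b b′ u v u′ v′} → Sel (cell , (a , b) , (u , v)) → Sel (cell , (a , b′) , (u′ , v′)) → u ≡ u′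
      row-constant {b = b} {b′} s s′ with isInRange (sel-valid s)
      ... | inRange (a< , b< , _) =
        let _ , s₀ = chosen a< (≤-trans (s≤s z≤n) b<) in trans (row-origin b s₀ s) (sym (row-origin b′ s₀ s′))

  -- `few` expresses the size of the code through duplicate-free lists, which lets `Sel` be a bare
  -- predicate on nodes.
  module Decode (Sel : Node → Set) (sel-valid : ∀ {p} → Sel p → Valid p)
    (perfect : ∀ {p} → Valid p → ∃ λ q → Sel q × Near p q × (∀ {q′} → Sel q′ → Near p q′ → q ≡ q′))
    (few : ∀ L → Unique L → All Sel L → length L ≤ k * k)
    where

    Selᵀ : Node → Set
    Selᵀ p = Sel (transpose p)

    selᵀ-valid : ∀ {p} → Selᵀ p → Valid p
    selᵀ-valid {p} s = subst Valid (transpose-involutive p) (transpose-valid adj-sym (sel-valid s))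

    perfectᵀ : ∀ {p} → Valid p → ∃ λ q → Selᵀ q × Near p q × (∀ {q′} → Selᵀ q′ → Near p q′ → q ≡ q′)
    perfectᵀ {p} p-valid =
      let q , s , near , only = perfect (transpose-valid adj-sym p-valid) in
      transpose q , subst Sel (sym (transpose-involutive q)) s ,
      subst (λ p → Near p (transpose q)) (transpose-involutive p) (Near-transpose near) ,
      λ {q′} s′ near′ → trans (cong transpose (only s′ (Near-transpose near′))) (transpose-involutive q′)

    module R = Rows Sel sel-valid perfect
    module C = Rows Selᵀ selᵀ-valid perfectᵀ

    Cells : Set
    Cells = Fin k × Fin k

    keeper : Cells → Node
    keeper (i , j) = proj₁ (perfect (R.guard-valid (toℕ<n i) (toℕ<n j)))

    keeper-sel : ∀ c → Sel (keeper c)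
    keeper-sel (i , j) = proj₁ (proj₂ (perfect (R.guard-valid (toℕ<n i) (toℕ<n j))))

    keeper-at : ∀ c → R.AtGuard (at c) (keeper c)
    keeper-at (i , j) =
      let q , s , near , _ = perfect (R.guard-valid (toℕ<n i) (toℕ<n j)) in
      R.near-guard (toℕ<n i) (toℕ<n j) (isInRange (sel-valid s)) near

    at-guard-position : ∀ {i q} → R.AtGuard i q → proj₁ (proj₂ q) ≡ i
    at-guard-position R.at-cell = refl
    at-guard-position R.at-row  = refl

    -- Whatever dominates a guard lies in the guard's own cell, so its position reveals the cell.
    keeper-injective : ∀ {c d} → keeper c ≡ keeper d → c ≡ d
    keeper-injective {c} {d} eq = at-injective (trans (sym (at-guard-position (keeper-at c)))
      (trans (cong (proj₁ ∘ proj₂) eq) (at-guard-position (keeper-at d))))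

    keepers : List Node
    keepers = tabulate (keeper ∘ remQuot {k} k)

    keepers-unique : Unique keepers
    keepers-unique = Unique.tabulate⁺ λ {i} {j} eq →
      trans (sym (combine-remQuot {k} k i)) (trans (cong (λ (x , y) → combine x y) (keeper-injective eq)) (combine-remQuot {k} k j))

    -- The k² keepers of the row guards are selected and differ from any
    -- selected column dummy, so the latter would exceed the size of the code.
    no-col : ∀ {i w} → ¬ Sel (col , i , w)
    no-col {i} {w} s = <⇒≱ (≤-reflexive (cong suc (sym (length-tabulate (keeper ∘ remQuot {k} k)))))
      (few ((col , i , w) ∷ keepers) (All.tabulate⁺ fresh ∷ keepers-unique)
        (s ∷ All.tabulate⁺ (keeper-sel ∘ remQuot {k} k)))
      where
      fresh : ∀ x → (col , i , w) ≢ keeper (remQuot {k} k x)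
      fresh x eq with keeper (remQuot {k} k x) | keeper-at (remQuot {k} k x)
      fresh x () | _ | R.at-cell
      fresh x () | _ | R.at-row

    -- The column guards are the ones to ask: the alternative to a pair is then a column dummy,
    -- which `no-col` excludes. In the transposed grid it appears as `at-row`.
    chosen : ∀ {a b} → a < k → b < k → ∃ λ w → Sel (cell , (a , b) , w)
    chosen {a} {b} a< b< with perfectᵀ (C.guard-valid b< a<)
    ... | q , s , near , _ with C.near-guard b< a< (isInRange (selᵀ-valid s)) near
    ... | C.at-cell = _ , s
    ... | C.at-row  = ⊥-elim (no-col s)

    chosenᵀ : ∀ {a b} → a < k → b < k → ∃ λ w → Selᵀ (cell , (a , b) , w)
    chosenᵀ a< b< = let (u , v) , s = chosen b< a< in (v , u) , s

    module R′ = R.Chosen chosen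
    module C′ = C.Chosen chosenᵀ

    φ : Fin k → ℕ
    φ i = proj₁ (proj₁ (chosen (toℕ<n i) (toℕ<n i)))

    φ< : ∀ i → φ i < n
    φ< i with chosen (toℕ<n i) (toℕ<n i)
    ... | _ , s with isInRange (sel-valid s)
    ... | inRange (_ , _ , u< , _) = u<

    φ-adj : ∀ {i j} → i ≢ j → T (adj (φ i) (φ j))
    φ-adj {i} {j} i≢j with chosen (toℕ<n i) (toℕ<n i) | chosen (toℕ<n j) (toℕ<n j) | chosen (toℕ<n i) (toℕ<n j)
    ... | (u , _) , s₁ | (u′ , v′) , s₂ | (x , y) , s
      -- The pair in cell (i , j) shares its first component with the diagonal pair of row i and its
      -- second with that of column j, whose two components agree.
      with refl ← allowed-diagonal {toℕ j} (allowed (sel-valid s₂))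
      with refl ← R′.row-constant s₁ s | refl ← C′.row-constant {u = u′} {v = v′} {u′ = y} {v′ = x} s₂ s
      = to (allowed-off-diagonal (i≢j ∘ toℕ-injective)) (allowed (sel-valid s))

    decoded : ∃ λ (φ : Fin k → ℕ) → (∀ i → φ i < n) × (∀ {i j} → i ≢ j → T (adj (φ i) (φ j)))
    decoded = φ , φ< , φ-adj

-- The interval graph of an instance

T-extensional : ∀ {x y} → T x ⇔ T y → x ≡ y
T-extensional {false} {false} _ = refl
T-extensional {true}  {true}  _ = refl
T-extensional {false} {true}  e = ⊥-elim (from e _)
T-extensional {true}  {false} e = ⊥-elim (to e _)

¬T⇒≡false : ∀ {x} → ¬ T x → x ≡ false
¬T⇒≡false {false} _  = refl
¬T⇒≡false {true}  ¬t = contradiction _ ¬t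

T-not : ∀ {x} → T (not x) ⇔ (¬ T x)
T-not {false} = mk⇔ (λ _ ()) (λ _ → _)
T-not {true}  = mk⇔ (λ ()) (λ ¬t → ¬t _)

lookup-injective : ∀ {A : Set} {xs : List A} → Unique xs → ∀ {i j} → lookup xs i ≡ lookup xs j → i ≡ j
lookup-injective (x∉ ∷ _)  {zero}  {zero}  eq = refl
lookup-injective (x∉ ∷ _)  {zero}  {suc j} eq = contradiction eq (All.lookup x∉ (∈-lookup j))
lookup-injective (x∉ ∷ _)  {suc i} {zero}  eq = contradiction (sym eq) (All.lookup x∉ (∈-lookup i))
lookup-injective (_ ∷ xs!) {suc i} {suc j} eq = cong suc (lookup-injective xs! eq)

∈⇒lookup : ∀ {A : Set} {x : A} {xs} → x ∈ˡ xs → ∃ λ i → lookup xs i ≡ x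
∈⇒lookup x∈ = Any.index x∈ , sym (lookup-index x∈)

enumerate : ∀ {n} (S : Subset n) → Fin ∣ S ∣ → Fin n
enumerate (true  ∷ S) zero    = zero
enumerate (true  ∷ S) (suc i) = suc (enumerate S i)
enumerate (false ∷ S) i       = suc (enumerate S i)

enumerate-∈ : ∀ {n} (S : Subset n) i → enumerate S i ∈ S
enumerate-∈ (true  ∷ S) zero    = Vec.here
enumerate-∈ (true  ∷ S) (suc i) = Vec.there (enumerate-∈ S i)
enumerate-∈ (false ∷ S) i       = Vec.there (enumerate-∈ S i)

enumerate-injective : ∀ {n} (S : Subset n) {i j} → enumerate S i ≡ enumerate S j → i ≡ j
enumerate-injective (true  ∷ S) {zero}  {zero}  eq = refl
enumerate-injective (true  ∷ S) {suc i} {suc j} eq = cong suc (enumerate-injective S (Fin.suc-injective eq))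
enumerate-injective (false ∷ S) eq = enumerate-injective S (Fin.suc-injective eq)

image : ∀ {m n} → (Fin m → Fin n) → Subset n
image {zero}  f = ∅
image {suc m} f = image (f ∘ suc) [ f zero ]≔ inside

∈-image⁺ : ∀ {m n} (f : Fin m → Fin n) i → f i ∈ image f
∈-image⁺ f zero    = Vec.[]≔-updates (image (f ∘ suc)) (f zero)
∈-image⁺ f (suc i) with f zero Fin.≟ f (suc i)
... | yes eq = subst (_∈ image f) eq (Vec.[]≔-updates (image (f ∘ suc)) (f zero))
... | no  ne = Vec.[]≔-minimal (image (f ∘ suc)) (f (suc i)) (f zero) (ne ∘ sym) (∈-image⁺ (f ∘ suc) i)

∈-image⁻ : ∀ {m n} (f : Fin m → Fin n) {x} → x ∈ image f → ∃ λ i → f i ≡ x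
∈-image⁻ {zero}  f x∈ = contradiction x∈ ∉⊥
∈-image⁻ {suc m} f {x} x∈ with f zero Fin.≟ x
... | yes eq = zero , eq
... | no  ne =
  let i , eq = ∈-image⁻ (f ∘ suc) (Vec.lookup⇒[]= x _
        (trans (sym (Vec.lookup∘update′ (ne ∘ sym) (image (f ∘ suc)) inside)) (Vec.[]=⇒lookup x∈)))
  in suc i , eq

∣insert∣ : ∀ {n} x (S : Subset n) → x ∉ S → ∣ S [ x ]≔ inside ∣ ≡ suc ∣ S ∣
∣insert∣ zero    (true  ∷ S) x∉ = contradiction Vec.here x∉
∣insert∣ zero    (false ∷ S) x∉ = refl
∣insert∣ (suc x) (true  ∷ S) x∉ = cong suc (∣insert∣ x S (x∉ ∘ Vec.there))
∣insert∣ (suc x) (false ∷ S) x∉ = ∣insert∣ x S (x∉ ∘ Vec.there)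

∣image∣ : ∀ {m n} (f : Fin m → Fin n) → (∀ {i j} → f i ≡ f j → i ≡ j) → ∣ image f ∣ ≡ m
∣image∣ {zero}  {n} f inj = ∣⊥∣≡0 n
∣image∣ {suc m} f inj = trans
  (∣insert∣ (f zero) (image (f ∘ suc)) λ f0∈ → let i , eq = ∈-image⁻ (f ∘ suc) f0∈ in
    case inj eq of λ ())
  (cong suc (∣image∣ (f ∘ suc) (Fin.suc-injective ∘ inj)))

module _ (w : ℕ) where

  private
    point : ℕ → ℚᵘ
    point s = mkℚᵘ (ℤ.+ s) w

    point+1 : ∀ s → point s ℚ.+ 1ℚᵘ ≡ point (s + suc w)
    point+1 s = cong₂ mkℚᵘ
      (cong₂ ℤ._+_ (ℤ.*-identityʳ (ℤ.+ s)) (ℤ.*-identityˡ (ℤ.+ suc w)))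
      (*-identityʳ w)

    point-≤ : ∀ {s t} → point s ℚ.≤ point t ⇔ s ≤ t
    point-≤ {s} {t} = mk⇔
      (λ { (*≤* le) → ℤ.drop‿+≤+ (ℤ.*-cancelʳ-≤-pos (ℤ.+ s) (ℤ.+ t) (ℤ.+ suc w) le) })
      (λ le → *≤* (ℤ.*-monoʳ-≤-nonNeg (ℤ.+ suc w) (ℤ.+≤+ le)))

  -- Over the common denominator `suc w` a unit length is `suc w` steps of the numerator. Once the
  -- starts are close, the larger one is a common point.
  unitIntervals-meet : ∀ {s t} → unitInterval (point s) ≬ unitInterval (point t) ⇔ Close (suc w) s t
  unitIntervals-meet {s} {t} = mk⇔
    (λ (x , (s≤ , ≤s) , (t≤ , ≤t)) → ends (ℚ.≤-trans s≤ ≤t) , ends (ℚ.≤-trans t≤ ≤s))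
    λ (s≤ , t≤) → case ≤-total s t of λ where
      (inj₁ s≤t) → point t , (from point-≤ s≤t , ends′ t≤) , (ℚ.≤-refl , ends′ (m≤m+n t _))
      (inj₂ t≤s) → point s , (ℚ.≤-refl , ends′ (m≤m+n s _)) , (from point-≤ t≤s , ends′ s≤)
    where
    ends : ∀ {s t} → point s ℚ.≤ point t ℚ.+ 1ℚᵘ → s ≤ t + suc w
    ends {s} {t} le = to point-≤ (subst (point s ℚ.≤_) (point+1 t) le)
    ends′ : ∀ {s t} → s ≤ t + suc w → point s ℚ.≤ point t ℚ.+ 1ℚᵘ
    ends′ {s} {t} le = subst (point s ℚ.≤_) (sym (point+1 t)) (from point-≤ le)

isSame⇔≡ : ∀ p q → T (isSame p q) ⇔ p ≡ q
isSame⇔≡ (κ , (a , b) , (u , v)) (κ′ , (a′ , b′) , (u′ , v′)) = mk⇔ forth back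
  where
  rank-injective : ∀ {κ κ′} → rank κ ≡ rank κ′ → κ ≡ κ′
  rank-injective {cell} {cell} _ = refl
  rank-injective {row}  {row}  _ = refl
  rank-injective {col}  {col}  _ = refl
  forth : T (isSame (κ , (a , b) , (u , v)) (κ′ , (a′ , b′) , (u′ , v′))) → (κ , (a , b) , (u , v)) ≡ (κ′ , (a′ , b′) , (u′ , v′))
  forth t =
    let tκ , t₁ = to (T-∧ {rank κ ≡ᵇ rank κ′}) t
        ta , t₂ = to (T-∧ {a ≡ᵇ a′}) t₁
        tb , t₃ = to (T-∧ {b ≡ᵇ b′}) t₂
        tu , tv = to (T-∧ {u ≡ᵇ u′}) t₃
    in cong₂ _,_ (rank-injective (≡ᵇ⇒≡ _ _ tκ)) (cong₂ _,_
         (cong₂ _,_ (≡ᵇ⇒≡ a a′ ta) (≡ᵇ⇒≡ b b′ tb)) (cong₂ _,_ (≡ᵇ⇒≡ u u′ tu) (≡ᵇ⇒≡ v v′ tv)))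
  back : (κ , (a , b) , (u , v)) ≡ (κ′ , (a′ , b′) , (u′ , v′)) → T (isSame (κ , (a , b) , (u , v)) (κ′ , (a′ , b′) , (u′ , v′)))
  back refl = from T-∧ (≡⇒≡ᵇ (rank κ) _ refl , from T-∧ (≡⇒≡ᵇ a a refl ,
    from T-∧ (≡⇒≡ᵇ b b refl , from T-∧ (≡⇒≡ᵇ u u refl , ≡⇒≡ᵇ v v refl))))

headOr-drop : ∀ {A : Set} {n} (d : A) (f : Fin n → A) i → headOr d (drop (toℕ i) (tabulate f)) ≡ f i
headOr-drop d f zero    = refl
headOr-drop d f (suc i) = headOr-drop d (f ∘ suc) i

matrix : Graph → List (List Bool)
matrix G = tabulate λ u → tabulate (Graph.adjacent G u)

entry-matrix : ∀ G u v → entry (matrix G) (toℕ u) (toℕ v) ≡ Graph.adjacent G u v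
entry-matrix G u v = trans
  (cong (λ us → headOr false (drop (toℕ v) us)) (headOr-drop [] (λ u → tabulate (Graph.adjacent G u)) u))
  (headOr-drop false (Graph.adjacent G u) v)

module Instance (G : Graph) (k : ℕ) where
  private module G = Graph G
  open Output (matrix G) k using (n)
  open Grid n k (entry (matrix G))

  n≡order : n ≡ G.order
  n≡order = length-tabulate _

  vertex : ∀ {u} → u < n → G.Vertex
  vertex u< = fromℕ< (≤-trans u< (≤-reflexive n≡order))

  toℕ-vertex : ∀ {u} (u< : u < n) → toℕ (vertex u<) ≡ u
  toℕ-vertex u< = toℕ-fromℕ< _

  entry-vertex : ∀ {u v} (u< : u < n) (v< : v < n) → entry (matrix G) u v ≡ G.adjacent (vertex u<) (vertex v<)
  entry-vertex u< v< = trans (sym (cong₂ (entry (matrix G)) (toℕ-vertex u<) (toℕ-vertex v<))) (entry-matrix G _ _)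

  adj-sym : ∀ {u v} → u < n → v < n → T (entry (matrix G) u v) → T (entry (matrix G) v u)
  adj-sym u< v< = subst T (trans (entry-vertex u< v<) (trans (G.symmetric _ _) (sym (entry-vertex v< u<))))

  Index : Set
  Index = Fin (length nodes)

  node-at : Index → Node
  node-at = lookup nodes

  node-at-valid : ∀ i → Valid (node-at i)
  node-at-valid i = ∈nodes⇒valid (∈-lookup i)

  node-at-injective : ∀ {i j} → node-at i ≡ node-at j → i ≡ j
  node-at-injective = lookup-injective nodes-unique

  locate-node : ∀ {p} → Valid p → ∃ λ i → node-at i ≡ p
  locate-node p-valid = ∈⇒lookup (valid⇒∈nodes p-valid)

  adjacentᵇ : Node → Node → Bool
  adjacentᵇ p q = not (isSame p q) ∧ joined p q

  adjacent⇔ : ∀ p q → T (adjacentᵇ p q) ⇔ (p ≢ q × Near p q)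
  adjacent⇔ p q = mk⇔
    (λ t → let l , r = to (T-∧ {not (isSame p q)}) t in to T-not l ∘ from (isSame⇔≡ p q) , to (joined⇔Near p q) r)
    (λ (ne , near) → from T-∧ (from T-not (ne ∘ to (isSame⇔≡ p q)) , from (joined⇔Near p q) near))

  graph : Graph
  graph = record
    { order       = length nodes
    ; adjacent    = λ i j → adjacentᵇ (node-at i) (node-at j)
    ; symmetric   = λ i j → T-extensional (mk⇔ (flip-adjacent i j) (flip-adjacent j i))
    ; irreflexive = λ i → ¬T⇒≡false λ t → proj₁ (to (adjacent⇔ (node-at i) (node-at i)) t) refl
    }
    where
    flip-adjacent : ∀ i j → T (adjacentᵇ (node-at i) (node-at j)) → T (adjacentᵇ (node-at j) (node-at i))
    flip-adjacent i j t = let ne , near = to (adjacent⇔ (node-at i) (node-at j)) t in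
      from (adjacent⇔ (node-at j) (node-at i)) (ne ∘ sym , Near-sym near)

  interval : Node → Unit2TrackInterval
  interval p = record
    { start₁ = mkℚᵘ (ℤ.+ start p) (n + n)
    ; start₂ = mkℚᵘ (ℤ.+ start (transpose p)) (n + n)
    }

  intervals-meet : ∀ p q → Near p q ⇔ Unit2TrackInterval.points (interval p) ≬ Unit2TrackInterval.points (interval q)
  intervals-meet p q = mk⇔
    (λ where
      (track₁ c) → let x , x∈ = from (unitIntervals-meet (n + n)) c in inj₁ x , x∈
      (track₂ c) → let x , x∈ = from (unitIntervals-meet (n + n)) c in inj₂ x , x∈)
    (λ where
      (inj₁ x , x∈) → track₁ (to (unitIntervals-meet (n + n)) (x , x∈))
      (inj₂ x , x∈) → track₂ (to (unitIntervals-meet (n + n)) (x , x∈)))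

  intervalGraph : Unit2TrackIntervalGraph
  intervalGraph = record
    { graph            = graph
    ; family           = interval ∘ node-at
    ; isRepresentation = λ i j i≢j → mk⇔
        (to (intervals-meet (node-at i) (node-at j)) ∘ proj₂ ∘ to (adjacent⇔ (node-at i) (node-at j)))
        (λ m → from (adjacent⇔ (node-at i) (node-at j)) (i≢j ∘ node-at-injective , from (intervals-meet (node-at i) (node-at j)) m))
    }

  neighbour⇔ : ∀ i j → Graph.N[_] graph i j ⇔ Near (node-at i) (node-at j)
  neighbour⇔ i j = mk⇔
    (λ { (inj₁ refl) → Near-refl _ ; (inj₂ t) → proj₂ (to (adjacent⇔ (node-at i) (node-at j)) t) })
    (λ near → case j Fin.≟ i of λ where
      (yes j≡i) → inj₁ j≡i
      (no  j≢i) → inj₂ (from (adjacent⇔ (node-at i) (node-at j)) (j≢i ∘ sym ∘ node-at-injective , near)))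

  clique⇒code : HasClique G k → HasPerfectCode graph (k * k)
  clique⇒code (S , clique , refl) = image f , perfect , ∣image∣ f f-injective
    where
    φ : Fin k → ℕ
    φ = toℕ ∘ enumerate S

    φ< : ∀ i → φ i < n
    φ< i = ≤-trans (toℕ<n (enumerate S i)) (≤-reflexive (sym n≡order))

    φ-adj : ∀ {i j} → i ≢ j → T (entry (matrix G) (φ i) (φ j))
    φ-adj {i} {j} i≢j = subst T (sym (entry-matrix G _ _))
      (clique _ _ (enumerate-∈ S i) (enumerate-∈ S j) (i≢j ∘ enumerate-injective S))

    open FromClique n k (entry (matrix G)) φ φ< φ-adj

    g : Fin k × Fin k → Index
    g c = proj₁ (locate-node (choice-valid c))

    node-at-g : ∀ c → node-at (g c) ≡ choice c
    node-at-g c = proj₂ (locate-node (choice-valid c))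

    f : Fin (k * k) → Index
    f = g ∘ remQuot {k} k

    f-injective : ∀ {x y} → f x ≡ f y → x ≡ y
    f-injective {x} {y} eq = trans (sym (combine-remQuot {k} k x)) (trans
      (cong (uncurry combine) (choice-injective (trans (sym (node-at-g _)) (trans (cong node-at eq) (node-at-g _)))))
      (combine-remQuot {k} k y))

    g-∈ : ∀ c → g c ∈ image f
    g-∈ c@(i , j) = subst (λ c → g c ∈ image f) (remQuot-combine i j) (∈-image⁺ f (combine i j))

    perfect : IsPerfectCode graph (image f)
    perfect i =
      let c , near , only = covered (node-at-valid i) in
      g c , (g-∈ c , from (neighbour⇔ i (g c)) (subst (Near (node-at i)) (sym (node-at-g c)) near)) ,
      λ {j} (j∈ , nb) → unique c only j∈ (to (neighbour⇔ i j) nb)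
      where
      unique : ∀ c → (∀ d → Near (node-at i) (choice d) → d ≡ c) → ∀ {j} → j ∈ image f → Near (node-at i) (node-at j) → g c ≡ j
      unique c only j∈ near with ∈-image⁻ f j∈
      ... | x , refl = cong g (sym (only (remQuot {k} k x) (subst (Near (node-at i)) (node-at-g _) near)))

  tuple⇒clique : (φ : Fin k → ℕ) → (∀ i → φ i < n) →
                 (∀ {i j} → i ≢ j → T (entry (matrix G) (φ i) (φ j))) → HasClique G k
  tuple⇒clique φ φ< φ-adj = image f , clique , ∣image∣ f f-injective
    where
    f : Fin k → G.Vertex
    f i = vertex (φ< i)

    f-adj : ∀ {i j} → i ≢ j → G.Adj (f i) (f j)
    f-adj {i} {j} i≢j = subst T (entry-vertex (φ< i) (φ< j)) (φ-adj i≢j)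

    -- Distinct indices yield adjacent vertices, and no vertex is adjacent to itself.
    f-injective : ∀ {i j} → f i ≡ f j → i ≡ j
    f-injective {i} {j} eq with i Fin.≟ j
    ... | yes i≡j = i≡j
    ... | no  i≢j = ⊥-elim (subst T (trans (cong (G.adjacent (f i)) (sym eq)) (G.irreflexive (f i))) (f-adj i≢j))

    clique : IsClique G (image f)
    clique u v u∈ v∈ u≢v with ∈-image⁻ f u∈ | ∈-image⁻ f v∈
    ... | i , refl | j , refl = f-adj λ { refl → u≢v refl }

  code⇒clique : HasPerfectCode graph (k * k) → HasClique G k
  code⇒clique (S , code , ∣S∣≡) =
    let φ , φ< , φ-adj = FromCode.Decode.decoded n k (entry (matrix G)) adj-sym
          (Selected S) selected-valid perfect few
    in tuple⇒clique φ φ< φ-adj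
    where
    Selected : Subset (length nodes) → Node → Set
    Selected S p = ∃ λ i → i ∈ S × node-at i ≡ p

    selected-valid : ∀ {p} → Selected S p → Valid p
    selected-valid (i , _ , refl) = node-at-valid i

    perfect : ∀ {p} → Valid p → ∃ λ q → Selected S q × Near p q × (∀ {q′} → Selected S q′ → Near p q′ → q ≡ q′)
    perfect p-valid with locate-node p-valid
    ... | i , refl =
      let j , (j∈ , nb) , only = code i in
      node-at j , (j , j∈ , refl) , to (neighbour⇔ i j) nb ,
      λ { (j′ , j′∈ , refl) near → cong node-at (only (j′∈ , from (neighbour⇔ i j′) near)) }

    -- The index of the head can be removed from `S`: the remaining entries differ from the head, so
    -- their indices survive.
    length≤∣_∣ : ∀ S L → Unique L → All (Selected S) L → length L ≤ ∣ S ∣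
    length≤∣ S ∣ []      _          _                       = z≤n
    length≤∣ S ∣ (p ∷ L) (p∉ ∷ L!) ((i , i∈ , i≡) ∷ sels) =
      ≤-trans (s≤s (length≤∣ S - i ∣ L L! (All.zipWith
        (λ { (p≢q , (j , j∈ , refl)) → j , x∈p∧x≢y⇒x∈p-y j∈ (λ { refl → p≢q (sym i≡) }) , refl }) (p∉ , sels))))
        (x∈p⇒∣p-x∣<∣p∣ i∈)

    few : ∀ L → Unique L → All (Selected S) L → length L ≤ k * k
    few L L! sels = ≤-trans (length≤∣ S ∣ L L! sels) (≤-reflexive ∣S∣≡)

-- Encodings of input and output

encodeList-cong : ∀ {A : Set} {e e′ : A → Tree} → (∀ x → e x ≡ e′ x) → ∀ xs → encodeList e xs ≡ encodeList e′ xs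
encodeList-cong eq []       = refl
encodeList-cong eq (x ∷ xs) = cong₂ node (eq x) (encodeList-cong eq xs)

encodeList-map : ∀ {A B : Set} (e : B → Tree) (f : A → B) xs → encodeList e (map f xs) ≡ encodeList (e ∘ f) xs
encodeList-map e f []       = refl
encodeList-map e f (x ∷ xs) = cong (node (e (f x))) (encodeList-map e f xs)

encodeVector-tabulate : ∀ {A : Set} (e : A → Tree) {n} (f : Fin n → A) → encodeVector e f ≡ encodeList e (tabulate f)
encodeVector-tabulate e {zero}  f = refl
encodeVector-tabulate e {suc n} f = cong (node (e (f zero))) (encodeVector-tabulate e (f ∘ suc))

encodeVector-lookup : ∀ {A B : Set} (e : B → Tree) (f : A → B) xs →
                      encodeVector e (f ∘ lookup xs) ≡ encodeList e (map f xs)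
encodeVector-lookup e f []       = refl
encodeVector-lookup e f (x ∷ xs) = cong (node (e (f x))) (encodeVector-lookup e f xs)

encodeMatrix : ∀ {A : Set} (e : A → Tree) {m n} (f : Fin m → Fin n → A) →
               encodeVector (encodeVector e) f ≡ encodeList (encodeList e) (tabulate λ u → tabulate (f u))
encodeMatrix e {zero}  f = refl
encodeMatrix e {suc m} f = cong₂ node (encodeVector-tabulate e (f zero)) (encodeMatrix e (f ∘ suc))

encode-input : ∀ G k → node (encodeGraph G) (encodeℕ k) ≡ encode Inputᵗ (matrix G , k)
encode-input G k = cong (λ t → node t (encodeℕ k)) (encodeMatrix encodeBool (Graph.adjacent G))

encode-output : ∀ G k → encode Outputᵗ (Output.output (matrix G) k) ≡
  node (encodeUnit2TrackIntervalGraph (Instance.intervalGraph G k)) (encodeℕ (k * k))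
encode-output G k = cong (λ t → node t (encodeℕ (k * k))) (cong₂ node adjacency≡ (sym intervals≡))
  where
  open Output (matrix G) k
  open Instance G k

  adjacency≡ : encode (Listᵗ (Listᵗ 𝔹)) adjacency ≡ encodeGraph graph
  adjacency≡ = begin
    encodeList (encodeList encodeBool) adjacency
      ≡⟨ encodeList-map (encodeList encodeBool) _ nodes ⟩
    encodeList (λ p → encodeList encodeBool (map (adjacentᵇ p) nodes)) nodes
      ≡⟨ encodeList-cong (λ p → sym (encodeVector-lookup encodeBool (adjacentᵇ p) nodes)) nodes ⟩
    encodeList (λ p → encodeVector encodeBool (adjacentᵇ p ∘ node-at)) nodes
      ≡⟨ sym (encodeList-map (encodeVector encodeBool) _ nodes) ⟩
    encodeList (encodeVector encodeBool) (map (λ p → adjacentᵇ p ∘ node-at) nodes)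
      ≡⟨ sym (encodeVector-lookup (encodeVector encodeBool) (λ p → adjacentᵇ p ∘ node-at) nodes) ⟩
    encodeGraph graph ∎
    where open ≡-Reasoning

  intervals≡ : encodeVector encode2Track (interval ∘ node-at) ≡ encode (Listᵗ (Fractionᵗ ⊗ Fractionᵗ)) intervals
  intervals≡ = begin
    encodeVector encode2Track (interval ∘ node-at)
      ≡⟨ encodeVector-lookup encode2Track interval nodes ⟩
    encodeList encode2Track (map interval nodes)
      ≡⟨ encodeList-map encode2Track interval nodes ⟩
    encodeList (encode2Track ∘ interval) nodes
      ≡⟨ sym (encodeList-map (encode (Fractionᵗ ⊗ Fractionᵗ)) _ nodes) ⟩
    encode (Listᵗ (Fractionᵗ ⊗ Fractionᵗ)) intervals ∎
    where open ≡-Reasoning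

-- From polynomial time to an FPT reduction

Instanceᵗ : ParameterizedProblem → Type
Instanceᵗ P = type (ParameterizedProblem.Instance P) (ParameterizedProblem.encode P)

computable : ∀ {f} → PolyTime ℕᵗ ℕᵗ f → Computable f
computable P = program P , λ n → let t , run , _ = computes P n in t , run

reduction : ∀ P Q {f h} (let module P = ParameterizedProblem P) (let module Q = ParameterizedProblem Q) →
            PolyTime (Instanceᵗ P) (Instanceᵗ Q) f → (∀ x → P.Yes x ⇔ Q.Yes (f x)) →
            PolyTime ℕᵗ ℕᵗ h → (∀ x → Q.parameter (f x) ≤ h (P.parameter x)) → FPTReduction P Q
reduction P Q {f} {h} F equiv H param≤ = record
  { reduce       = f
  ; equivalent   = equiv
  ; program      = program F
  -- Every tree has size s ≥ 1, so 2 + s ≤ 3 * s, and the shift in the base costs only the constant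
  -- factor `3 ^ e`.
  ; g            = λ _ → 3 ^ e
  ; g-computable = computable (constant (3 ^ e))
  ; exponent     = e
  ; computes     = λ x → let t , run , t≤ = computes F x in
      t , run , ≤-trans (bounded t≤) (base e (size>0 (ParameterizedProblem.encode P x)))
  ; h            = h
  ; h-computable = computable H
  ; parameter-≤  = param≤
  }
  where
  e = exponent F
  base : ∀ e {s} → 1 ≤ s → (2 + s) ^ e ≤ 3 ^ e * s ^ e
  base zero    1≤s = ≤-refl
  base (suc e) {s} 1≤s = begin
    (2 + s) * (2 + s) ^ e       ≤⟨ *-mono-≤ linear (base e 1≤s) ⟩
    (3 * s) * (3 ^ e * s ^ e)   ≡⟨ [m*n]*[o*p]≡[m*o]*[n*p] 3 s (3 ^ e) (s ^ e) ⟩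
    3 ^ suc e * s ^ suc e       ∎
    where
    open ≤-Reasoning
    linear : 2 + s ≤ 3 * s
    linear = begin
      2 + s       ≡⟨ +-comm 2 s ⟩
      s + 2 * 1   ≤⟨ +-monoʳ-≤ s (*-monoʳ-≤ 2 1≤s) ⟩
      3 * s       ∎

theorem8 : W[1]-Hard kPerfectCode-Unit2TrackIntervalGraph
theorem8 = reduction kClique kPerfectCode-Unit2TrackIntervalGraph
  {f = λ (G , k) → Instance.intervalGraph G k , k * k}
  (reencode (λ (G , k) → encode-output G k)
    (outputᵖ ∙ recode {f = λ (G , k) → matrix G , k} (λ (G , k) → encode-input G k)))
  (λ (G , k) → mk⇔ (Instance.clique⇒code G k) (Instance.code⇒clique G k))
  (identity ⟨*⟩ identity) (λ _ → ≤-refl)
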